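{- Let $0<\alpha<1$. The worst-case running time, over uncertain graphs on $n$ vertices, of any algorithm that outputs all $\alpha$-maximal cliques of its input uncertain graph is $\Omega(\sqrt{n}\cdot 2^n)$.
   Context: An uncertain graph is a triple $\mathcal{G}=(V,E,p)$, where $V$ is a finite set of vertices, $E$ is a set of undirected edges on $V$ (no self-loops, no multiple edges), and $p:E\to(0,1]$. It represents the distribution over subgraphs of $(V,E)$ obtained by including each edge $e\in E$ independently with probability $p(e)$. For $C\subseteq V$, $\mathrm{clq}(C,\mathcal{G})$ is the probability that $C$ is a clique (all pairs of distinct vertices adjacent) in a sampled graph. $C$ is an $\alpha$-clique if $\mathrm{clq}(C,\mathcal{G})\ge\alpha$. $M\subseteq V$ is an $\alpha$-maximal clique if $M$ is an $\alpha$-clique and there is no $v\in V\setminus M$ such that $M\cup\{v\}$ is an $\alpha$-clique. An algorithm must write out each $\alpha$-maximal clique explicitly as a list of its vertices, and its running time is at least the total output size, i.e. the sum of the cardinalities of all the sets it outputs. -}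

module Defs where

open import Data.Bool using (if_then_else_)
open import Data.Fin as Fin using (Fin)
import Data.Fin.Properties as Finₚ
open import Data.Fin.Subset using (Subset; inside; outside; _∈_; _∉_; _∪_; ⁅_⁆)
open import Data.Fin.Subset.Properties using (_∈?_)
open import Data.Integer as ℤ using (+_; +[1+_]; -[1+_])
import Data.Integer.Properties as ℤₚ
open import Data.List using (List; []; _∷_; map; _++_; filter; foldr; length; sum)
open import Data.List.Membership.Propositional using () renaming (_∈_ to _∈ˡ_)
open import Data.List.Relation.Unary.Unique.Propositional using (Unique)
open import Data.Nat as ℕ using (ℕ; zero; suc; z≤n; s≤s)
import Data.Nat.Properties as ℕₚ
open import Data.Nat.Tactic.RingSolver using (solve-∀)
open import Data.Product using (∃; ∃-syntax; _×_; _,_; proj₁; proj₂)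
import Data.Product.Properties as ×ₚ
open import Data.Rational as ℚ using (ℚ; mkℚ; 0ℚ; 1ℚ; ½)
import Data.Rational.Properties as ℚₚ
open import Data.Rational.Solver using (module +-*-Solver)
open import Data.Rational.Unnormalised as ℚᵘ using (mkℚᵘ)
import Data.Rational.Unnormalised.Properties as ℚᵘₚ
open import Data.Sum using (_⊎_; inj₁; inj₂)
open import Data.Vec using ([]; _∷_; lookup)
import Data.Vec.Functional as Vector
open import Function.Bundles using (_⇔_)
open import Function.Definitions using (Injective)
open import Relation.Binary.PropositionalEquality
open import Relation.Nullary using (¬_; Dec; yes; no; contradiction)
open import Relation.Nullary.Decidable using (_→-dec_; _×-dec_; _⊎-dec_; ¬?)

-- Real numbers, as Cauchy sequences of rationals.  The operations are
-- pointwise; two sequences denote the same real when x ≤ y and y ≤ x.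

IsCauchy : (ℕ → ℚ) → Set
IsCauchy x = ∀ ε → 0ℚ ℚ.< ε →
  ∃[ N ] (∀ i j → N ℕ.≤ i → N ℕ.≤ j → ℚ.∣ x i ℚ.- x j ∣ ℚ.≤ ε)

record ℝ : Set where
  constructor mkℝ
  field
    seq    : ℕ → ℚ
    cauchy : IsCauchy seq

open ℝ public

infix 4 _≤_ _<_

_≤_ : ℝ → ℝ → Set
x ≤ y = ∀ ε → 0ℚ ℚ.< ε → ∃[ N ] (∀ i → N ℕ.≤ i → seq x i ℚ.≤ seq y i ℚ.+ ε)

_<_ : ℝ → ℝ → Set
x < y = ∃[ ε ] (0ℚ ℚ.< ε × ∃[ N ] (∀ i → N ℕ.≤ i → seq x i ℚ.+ ε ℚ.≤ seq y i))

open +-*-Solver using (solve; _:=_; _:+_; :-_; _:-_)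

private abstract
  ε/2 : ℚ → ℚ
  ε/2 ε = ½ ℚ.* ε

  ε/2>0 : ∀ {ε} → 0ℚ ℚ.< ε → 0ℚ ℚ.< ε/2 ε
  ε/2>0 {ε} 0<ε = subst (ℚ._< ε/2 ε) (ℚₚ.*-zeroʳ ½) (ℚₚ.*-monoʳ-<-pos ½ 0<ε)

  ε/2+ε/2 : ∀ ε → ε/2 ε ℚ.+ ε/2 ε ≡ ε
  ε/2+ε/2 ε = trans (sym (ℚₚ.*-distribʳ-+ ε ½ ½)) (ℚₚ.*-identityˡ ε)

  ⊔≤ˡ : ∀ {a b c} → a ℕ.⊔ b ℕ.≤ c → a ℕ.≤ c
  ⊔≤ˡ {a} {b} = ℕₚ.≤-trans (ℕₚ.m≤m⊔n a b)

  ⊔≤ʳ : ∀ {a b c} → a ℕ.⊔ b ℕ.≤ c → b ℕ.≤ c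
  ⊔≤ʳ {a} {b} = ℕₚ.≤-trans (ℕₚ.m≤n⊔m a b)

  const-cauchy : ∀ q → IsCauchy (λ _ → q)
  const-cauchy q ε 0<ε = 0 , λ _ _ _ _ →
    subst (ℚ._≤ ε) (sym (cong ℚ.∣_∣ (ℚₚ.+-inverseʳ q))) (ℚₚ.<⇒≤ 0<ε)

  +-cauchy : ∀ {x y} → IsCauchy x → IsCauchy y → IsCauchy (λ i → x i ℚ.+ y i)
  +-cauchy {x} {y} cx cy ε 0<ε
    with cx (ε/2 ε) (ε/2>0 0<ε) | cy (ε/2 ε) (ε/2>0 0<ε)
  ... | M , hx | N , hy = M ℕ.⊔ N , λ i j i≥ j≥ → begin
    ℚ.∣ x i ℚ.+ y i ℚ.- (x j ℚ.+ y j) ∣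
      ≡⟨ cong ℚ.∣_∣ (solve 4 (λ a b c d →
           (a :+ b) :- (c :+ d) := (a :- c) :+ (b :- d)) refl (x i) (y i) (x j) (y j)) ⟩
    ℚ.∣ (x i ℚ.- x j) ℚ.+ (y i ℚ.- y j) ∣
      ≤⟨ ℚₚ.∣p+q∣≤∣p∣+∣q∣ (x i ℚ.- x j) (y i ℚ.- y j) ⟩
    ℚ.∣ x i ℚ.- x j ∣ ℚ.+ ℚ.∣ y i ℚ.- y j ∣
      ≤⟨ ℚₚ.+-mono-≤ (hx i j (⊔≤ˡ i≥) (⊔≤ˡ j≥))
                     (hy i j (⊔≤ʳ {M} i≥) (⊔≤ʳ {M} j≥)) ⟩
    ε/2 ε ℚ.+ ε/2 ε
      ≡⟨ ε/2+ε/2 ε ⟩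
    ε ∎
    where open ℚₚ.≤-Reasoning

  neg-cauchy : ∀ {x} → IsCauchy x → IsCauchy (λ i → ℚ.- x i)
  neg-cauchy {x} cx ε 0<ε with cx ε 0<ε
  ... | N , hx = N , λ i j i≥ j≥ →
    subst (ℚ._≤ ε)
      (trans (sym (ℚₚ.∣-p∣≡∣p∣ (x i ℚ.- x j)))
             (cong ℚ.∣_∣ (solve 2 (λ a b → :- (a :- b) := :- a :- :- b) refl (x i) (x j))))
      (hx i j i≥ j≥)

  0<1 : 0ℚ ℚ.< 1ℚ
  0<1 = ℚₚ.positive⁻¹ 1ℚ

  bounded : ∀ {x} → IsCauchy x →
    ∃[ B ] (0ℚ ℚ.< B × ∃[ N ] (∀ i → N ℕ.≤ i → ℚ.∣ x i ∣ ℚ.≤ B))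
  bounded {x} cx with cx 1ℚ 0<1
  ... | N , hx = 1ℚ ℚ.+ ℚ.∣ x N ∣ , pos , N , bound
    where
    open ℚₚ.≤-Reasoning
    pos : 0ℚ ℚ.< 1ℚ ℚ.+ ℚ.∣ x N ∣
    pos = ℚₚ.+-mono-<-≤ 0<1 (ℚₚ.0≤∣p∣ (x N))
    bound : ∀ i → N ℕ.≤ i → ℚ.∣ x i ∣ ℚ.≤ 1ℚ ℚ.+ ℚ.∣ x N ∣
    bound i i≥ = begin
      ℚ.∣ x i ∣
        ≡⟨ cong ℚ.∣_∣ (solve 2 (λ a b → a := (a :- b) :+ b) refl (x i) (x N)) ⟩
      ℚ.∣ (x i ℚ.- x N) ℚ.+ x N ∣
        ≤⟨ ℚₚ.∣p+q∣≤∣p∣+∣q∣ (x i ℚ.- x N) (x N) ⟩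
      ℚ.∣ x i ℚ.- x N ∣ ℚ.+ ℚ.∣ x N ∣
        ≤⟨ ℚₚ.+-monoˡ-≤ ℚ.∣ x N ∣ (hx i N i≥ ℕₚ.≤-refl) ⟩
      1ℚ ℚ.+ ℚ.∣ x N ∣ ∎

  scale : ∀ B → 0ℚ ℚ.< B → ∀ ε → 0ℚ ℚ.< ε → ∃[ δ ] (0ℚ ℚ.< δ × B ℚ.* δ ≡ ε)
  scale B 0<B ε 0<ε = (ℚ.1/ B) ℚ.* ε , pos , eq
    where
    instance
      B>0 : ℚ.Positive B
      B>0 = ℚ.positive 0<B
      B≢0 : ℚ.NonZero B
      B≢0 = ℚₚ.pos⇒nonZero B
      1/B>0 : ℚ.Positive (ℚ.1/ B)
      1/B>0 = ℚₚ.1/pos⇒pos B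
    pos : 0ℚ ℚ.< (ℚ.1/ B) ℚ.* ε
    pos = subst (ℚ._< (ℚ.1/ B) ℚ.* ε) (ℚₚ.*-zeroʳ (ℚ.1/ B)) (ℚₚ.*-monoʳ-<-pos (ℚ.1/ B) 0<ε)
    eq : B ℚ.* ((ℚ.1/ B) ℚ.* ε) ≡ ε
    eq = trans (sym (ℚₚ.*-assoc B (ℚ.1/ B) ε))
           (trans (cong (ℚ._* ε) (ℚₚ.*-inverseʳ B)) (ℚₚ.*-identityˡ ε))

  ∣*∣-mono : ∀ {p q r s} → ℚ.∣ p ∣ ℚ.≤ r → ℚ.∣ q ∣ ℚ.≤ s → ℚ.∣ p ℚ.* q ∣ ℚ.≤ r ℚ.* s
  ∣*∣-mono {p} {q} {r} {s} p≤r q≤s = begin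
    ℚ.∣ p ℚ.* q ∣           ≡⟨ ℚₚ.∣p*q∣≡∣p∣*∣q∣ p q ⟩
    ℚ.∣ p ∣ ℚ.* ℚ.∣ q ∣     ≤⟨ ℚₚ.*-monoʳ-≤-nonNeg ℚ.∣ q ∣ {{ℚₚ.∣-∣-nonNeg q}} p≤r ⟩
    r ℚ.* ℚ.∣ q ∣           ≤⟨ ℚₚ.*-monoˡ-≤-nonNeg r {{r≥0}} q≤s ⟩
    r ℚ.* s ∎
    where
    open ℚₚ.≤-Reasoning
    r≥0 : ℚ.NonNegative r
    r≥0 = ℚ.nonNegative (ℚₚ.≤-trans (ℚₚ.0≤∣p∣ p) p≤r)

  *-diff : ∀ a b c d → a ℚ.* b ℚ.- c ℚ.* d ≡ a ℚ.* (b ℚ.- d) ℚ.+ d ℚ.* (a ℚ.- c)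
  *-diff a b c d = begin
    a ℚ.* b ℚ.- c ℚ.* d
      ≡⟨ solve 3 (λ p q r → p :- q := (p :- r) :+ (r :- q)) refl (a ℚ.* b) (c ℚ.* d) (a ℚ.* d) ⟩
    (a ℚ.* b ℚ.- a ℚ.* d) ℚ.+ (a ℚ.* d ℚ.- c ℚ.* d)
      ≡⟨ cong₂ (λ s t → (a ℚ.* b ℚ.- a ℚ.* d) ℚ.+ (s ℚ.- t)) (ℚₚ.*-comm a d) (ℚₚ.*-comm c d) ⟩
    (a ℚ.* b ℚ.- a ℚ.* d) ℚ.+ (d ℚ.* a ℚ.- d ℚ.* c)
      ≡⟨ cong₂ ℚ._+_ (factor a b d) (factor d a c) ⟩
    a ℚ.* (b ℚ.- d) ℚ.+ d ℚ.* (a ℚ.- c) ∎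
    where
    open ≡-Reasoning
    factor : ∀ p q r → p ℚ.* q ℚ.- p ℚ.* r ≡ p ℚ.* (q ℚ.- r)
    factor p q r = trans (cong (p ℚ.* q ℚ.+_) (ℚₚ.neg-distribʳ-* p r))
                         (sym (ℚₚ.*-distribˡ-+ p q (ℚ.- r)))

  *-estimate : ∀ {A B η δ} a b c d →
    ℚ.∣ a ∣ ℚ.≤ A → ℚ.∣ b ℚ.- d ∣ ℚ.≤ η → ℚ.∣ d ∣ ℚ.≤ B → ℚ.∣ a ℚ.- c ∣ ℚ.≤ δ →
    ℚ.∣ a ℚ.* b ℚ.- c ℚ.* d ∣ ℚ.≤ A ℚ.* η ℚ.+ B ℚ.* δ
  *-estimate {A} {B} {η} {δ} a b c d a≤A bd≤η d≤B ac≤δ = begin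
    ℚ.∣ a ℚ.* b ℚ.- c ℚ.* d ∣
      ≡⟨ cong ℚ.∣_∣ (*-diff a b c d) ⟩
    ℚ.∣ a ℚ.* (b ℚ.- d) ℚ.+ d ℚ.* (a ℚ.- c) ∣
      ≤⟨ ℚₚ.∣p+q∣≤∣p∣+∣q∣ (a ℚ.* (b ℚ.- d)) (d ℚ.* (a ℚ.- c)) ⟩
    ℚ.∣ a ℚ.* (b ℚ.- d) ∣ ℚ.+ ℚ.∣ d ℚ.* (a ℚ.- c) ∣
      ≤⟨ ℚₚ.+-mono-≤ (∣*∣-mono {a} {b ℚ.- d} {A} {η} a≤A bd≤η)
                     (∣*∣-mono {d} {a ℚ.- c} {B} {δ} d≤B ac≤δ) ⟩
    A ℚ.* η ℚ.+ B ℚ.* δ ∎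
    where open ℚₚ.≤-Reasoning

  *-cauchy : ∀ {x y} → IsCauchy x → IsCauchy y → IsCauchy (λ i → x i ℚ.* y i)
  *-cauchy {x} {y} cx cy ε 0<ε =
    let A , A>0 , K , hA = bounded {x} cx
        B , B>0 , L , hB = bounded {y} cy
        η , η>0 , Aη     = scale A A>0 (ε/2 ε) (ε/2>0 {ε} 0<ε)
        δ , δ>0 , Bδ     = scale B B>0 (ε/2 ε) (ε/2>0 {ε} 0<ε)
        M , hx           = cx δ δ>0
        N , hy           = cy η η>0
    in (K ℕ.⊔ L) ℕ.⊔ (M ℕ.⊔ N) , λ i j i≥ j≥ →
      subst (ℚ.∣ x i ℚ.* y i ℚ.- x j ℚ.* y j ∣ ℚ.≤_)
        (trans (cong₂ ℚ._+_ Aη Bδ) (ε/2+ε/2 ε))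
        (*-estimate {A} {B} {η} {δ} (x i) (y i) (x j) (y j)
          (hA i (⊔≤ˡ {K} (⊔≤ˡ {K ℕ.⊔ L} i≥)))
          (hy i j (⊔≤ʳ {M} (⊔≤ʳ {K ℕ.⊔ L} i≥)) (⊔≤ʳ {M} (⊔≤ʳ {K ℕ.⊔ L} j≥)))
          (hB j (⊔≤ʳ {K} (⊔≤ˡ {K ℕ.⊔ L} j≥)))
          (hx i j (⊔≤ˡ {M} (⊔≤ʳ {K ℕ.⊔ L} i≥)) (⊔≤ˡ {M} (⊔≤ʳ {K ℕ.⊔ L} j≥))))

infixl 6 _+_ _-_
infixl 7 _*_

fromℚ : ℚ → ℝ
fromℚ q = mkℝ (λ _ → q) (const-cauchy q)

fromℕ : ℕ → ℝ
fromℕ n = fromℚ (+ n ℚ./ 1)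

0ℝ 1ℝ : ℝ
0ℝ = fromℚ 0ℚ
1ℝ = fromℚ 1ℚ

_+_ : ℝ → ℝ → ℝ
x + y = mkℝ (λ i → seq x i ℚ.+ seq y i) (+-cauchy {seq x} {seq y} (cauchy x) (cauchy y))

_-_ : ℝ → ℝ → ℝ
x - y = mkℝ (λ i → seq x i ℚ.- seq y i) 
  (+-cauchy {seq x} {λ i → ℚ.- seq y i} (cauchy x) (neg-cauchy {seq y} (cauchy y)))

_*_ : ℝ → ℝ → ℝ
x * y = mkℝ (λ i → seq x i ℚ.* seq y i) (*-cauchy {seq x} {seq y} (cauchy x) (cauchy y))

-- ⌊√n⌋
isqrt : ℕ → ℕ
isqrt zero = 0
isqrt (suc n) with suc (isqrt n) ℕ.* suc (isqrt n) ℕ.≤? suc n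
... | yes _ = suc (isqrt n)
... | no  _ = isqrt n

isqrt-lower : ∀ n → isqrt n ℕ.* isqrt n ℕ.≤ n
isqrt-lower zero = z≤n
isqrt-lower (suc n) with suc (isqrt n) ℕ.* suc (isqrt n) ℕ.≤? suc n
... | yes p = p
... | no  _ = ℕₚ.m≤n⇒m≤1+n (isqrt-lower n)

isqrt-upper : ∀ n → n ℕ.< suc (isqrt n) ℕ.* suc (isqrt n)
isqrt-upper zero = s≤s z≤n
isqrt-upper (suc n) with suc (isqrt n) ℕ.* suc (isqrt n) ℕ.≤? suc n
... | yes _ = ℕₚ.≤-<-trans (isqrt-upper n)
                (ℕₚ.*-mono-< (ℕₚ.n<1+n (suc (isqrt n))) (ℕₚ.n<1+n (suc (isqrt n))))
... | no ¬p = ℕₚ.≰⇒> ¬p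

-- The i-th approximation lies within 1/(i+1) below the square root.
√-seq : ℕ → ℕ → ℚ
√-seq n i = + isqrt (n ℕ.* (suc i ℕ.* suc i)) ℚ./ suc i

private abstract
  cross : ∀ n J K a b → a ℕ.* a ℕ.≤ n ℕ.* (J ℕ.* J) → n ℕ.* (K ℕ.* K) ℕ.≤ b ℕ.* b →
          a ℕ.* K ℕ.≤ b ℕ.* J
  cross n J K a b a²≤ ≤b² with a ℕ.* K ℕ.≤? b ℕ.* J
  ... | yes p = p
  ... | no ¬p = contradiction (ℕₚ.*-mono-< (ℕₚ.≰⇒> ¬p) (ℕₚ.≰⇒> ¬p)) (ℕₚ.≤⇒≯ (begin
    (a ℕ.* K) ℕ.* (a ℕ.* K)              ≡⟨ sq a K ⟩
    (a ℕ.* a) ℕ.* (K ℕ.* K)              ≤⟨ ℕₚ.*-monoˡ-≤ (K ℕ.* K) a²≤ ⟩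
    (n ℕ.* (J ℕ.* J)) ℕ.* (K ℕ.* K)      ≡⟨ swap n (J ℕ.* J) (K ℕ.* K) ⟩
    (n ℕ.* (K ℕ.* K)) ℕ.* (J ℕ.* J)      ≤⟨ ℕₚ.*-monoˡ-≤ (J ℕ.* J) ≤b² ⟩
    (b ℕ.* b) ℕ.* (J ℕ.* J)              ≡⟨ sq b J ⟨
    (b ℕ.* J) ℕ.* (b ℕ.* J) ∎))
    where
    open ℕₚ.≤-Reasoning
    sq : ∀ p q → (p ℕ.* q) ℕ.* (p ℕ.* q) ≡ (p ℕ.* p) ℕ.* (q ℕ.* q)
    sq = solve-∀
    swap : ∀ p q r → (p ℕ.* q) ℕ.* r ≡ (p ℕ.* r) ℕ.* q
    swap = solve-∀

  isqrt-cross : ∀ n J K →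
    isqrt (n ℕ.* (J ℕ.* J)) ℕ.* K ℕ.≤ suc (isqrt (n ℕ.* (K ℕ.* K))) ℕ.* J
  isqrt-cross n J K = cross n J K (isqrt (n ℕ.* (J ℕ.* J))) (suc (isqrt (n ℕ.* (K ℕ.* K))))
    (isqrt-lower (n ℕ.* (J ℕ.* J)))
    (ℕₚ.<⇒≤ (isqrt-upper (n ℕ.* (K ℕ.* K))))

  /-mono : ∀ a b j k → a ℕ.* suc k ℕ.≤ b ℕ.* suc j → + a ℚ./ suc j ℚ.≤ + b ℚ./ suc k
  /-mono a b j k h = ℚₚ.toℚᵘ-cancel-≤ (begin
    ℚ.toℚᵘ (+ a ℚ./ suc j)  ≃⟨ ℚₚ.toℚᵘ-fromℚᵘ (mkℚᵘ (+ a) j) ⟩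
    mkℚᵘ (+ a) j            ≤⟨ ℚᵘ.*≤* (subst₂ ℤ._≤_ (ℤₚ.pos-* a (suc k)) (ℤₚ.pos-* b (suc j)) (ℤ.+≤+ h)) ⟩
    mkℚᵘ (+ b) k            ≃⟨ ℚₚ.toℚᵘ-fromℚᵘ (mkℚᵘ (+ b) k) ⟨
    ℚ.toℚᵘ (+ b ℚ./ suc k) ∎)
    where open ℚᵘₚ.≤-Reasoning

  /-suc : ∀ b k → + suc b ℚ./ suc k ≡ + b ℚ./ suc k ℚ.+ + 1 ℚ./ suc k
  /-suc b k = ℚₚ.toℚᵘ-injective (begin
    ℚ.toℚᵘ (+ suc b ℚ./ suc k)  ≈⟨ ℚₚ.toℚᵘ-fromℚᵘ (mkℚᵘ (+ suc b) k) ⟩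
    mkℚᵘ (+ suc b) k
      ≈⟨ ℚᵘ.*≡* (trans (sym (ℤₚ.pos-* (suc b) (suc k ℕ.* suc k)))
           (trans (cong +_ (alg b k)) (trans (ℤₚ.pos-* (b ℕ.* suc k ℕ.+ 1 ℕ.* suc k) (suc k)) (cong (ℤ._* + suc k)
             (trans (ℤₚ.pos-+ (b ℕ.* suc k) (1 ℕ.* suc k))
               (cong₂ ℤ._+_ (ℤₚ.pos-* b (suc k)) (ℤₚ.pos-* 1 (suc k)))))))) ⟩
    mkℚᵘ (+ b) k ℚᵘ.+ mkℚᵘ (+ 1) k
      ≈⟨ ℚᵘₚ.+-cong (ℚₚ.toℚᵘ-fromℚᵘ (mkℚᵘ (+ b) k)) (ℚₚ.toℚᵘ-fromℚᵘ (mkℚᵘ (+ 1) k)) ⟨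
    ℚ.toℚᵘ (+ b ℚ./ suc k) ℚᵘ.+ ℚ.toℚᵘ (+ 1 ℚ./ suc k)
      ≈⟨ ℚₚ.toℚᵘ-homo-+ (+ b ℚ./ suc k) (+ 1 ℚ./ suc k) ⟨
    ℚ.toℚᵘ (+ b ℚ./ suc k ℚ.+ + 1 ℚ./ suc k) ∎)
    where
    open import Relation.Binary.Reasoning.Setoid ℚᵘₚ.≃-setoid
    alg : ∀ b k → suc b ℕ.* (suc k ℕ.* suc k) ≡ (b ℕ.* suc k ℕ.+ 1 ℕ.* suc k) ℕ.* suc k
    alg = solve-∀

  archimedean : ∀ ε → 0ℚ ℚ.< ε → ∃[ N ] (∀ i → N ℕ.≤ i → + 1 ℚ./ suc i ℚ.≤ ε)
  archimedean (mkℚ (+ zero) d c) (ℚ.*<* (ℤ.+<+ ()))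
  archimedean (mkℚ -[1+ n ] d c) (ℚ.*<* ())
  archimedean ε@(mkℚ +[1+ n ] d c) _ = d , λ i d≤i →
    subst (+ 1 ℚ./ suc i ℚ.≤_) (ℚₚ.fromℚᵘ-toℚᵘ ε)
      (/-mono 1 (suc n) i d
        (ℕₚ.≤-trans (ℕₚ.≤-reflexive (ℕₚ.*-identityˡ (suc d)))
          (ℕₚ.≤-trans (s≤s d≤i) (ℕₚ.m≤m+n (suc i) (n ℕ.* suc i)))))

  √-step : ∀ n i j → √-seq n i ℚ.- √-seq n j ℚ.≤ + 1 ℚ./ suc j
  √-step n i j = begin
    √-seq n i ℚ.- √-seq n j
      ≤⟨ ℚₚ.+-monoˡ-≤ (ℚ.- √-seq n j) (ℚₚ.≤-trans
           (/-mono (isqrt (n ℕ.* (suc i ℕ.* suc i))) (suc b) i j (isqrt-cross n (suc i) (suc j)))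
           (ℚₚ.≤-reflexive (/-suc b j))) ⟩
    √-seq n j ℚ.+ + 1 ℚ./ suc j ℚ.- √-seq n j
      ≡⟨ solve 2 (λ a e → (a :+ e) :- a := e) refl (√-seq n j) (+ 1 ℚ./ suc j) ⟩
    + 1 ℚ./ suc j ∎
    where
    open ℚₚ.≤-Reasoning
    b : ℕ
    b = isqrt (n ℕ.* (suc j ℕ.* suc j))

  √-cauchy : ∀ n → IsCauchy (√-seq n)
  √-cauchy n ε 0<ε with archimedean ε 0<ε
  ... | N , h = N , λ i j i≥ j≥ → ∣∣≤ i j i≥ j≥ (ℚₚ.∣p∣≡p∨∣p∣≡-p (√-seq n i ℚ.- √-seq n j))
    where
    ∣∣≤ : ∀ i j → N ℕ.≤ i → N ℕ.≤ j →
      let d = √-seq n i ℚ.- √-seq n j in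
      ℚ.∣ d ∣ ≡ d ⊎ ℚ.∣ d ∣ ≡ ℚ.- d → ℚ.∣ d ∣ ℚ.≤ ε
    ∣∣≤ i j i≥ j≥ (inj₁ eq) = subst (ℚ._≤ ε) (sym eq) (ℚₚ.≤-trans (√-step n i j) (h j j≥))
    ∣∣≤ i j i≥ j≥ (inj₂ eq) = subst (ℚ._≤ ε)
      (sym (trans eq (solve 2 (λ a b → :- (a :- b) := b :- a) refl (√-seq n i) (√-seq n j))))
      (ℚₚ.≤-trans (√-step n j i) (h i i≥))

√ : ℕ → ℝ
√ n = mkℝ (√-seq n) (√-cauchy n)

-- The vertex set is Fin n and the edge set is Fin m.  Orienting every edge
-- from its smaller endpoint excludes self-loops, and makes injectivity of
-- `ends` exclude multiple edges.

record UncertainGraph (n : ℕ) : Set where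
  field
    m        : ℕ
    ends     : Fin m → Fin n × Fin n
    oriented : ∀ e → proj₁ (ends e) Fin.< proj₂ (ends e)
    simple   : Injective _≡_ _≡_ ends
    p        : Fin m → ℝ
    p>0      : ∀ e → 0ℝ < p e
    p≤1      : ∀ e → p e ≤ 1ℝ

subsets : ∀ m → List (Subset m)
subsets zero    = [] ∷ []
subsets (suc m) = map (inside ∷_) (subsets m) ++ map (outside ∷_) (subsets m)

sumℝ : List ℝ → ℝ
sumℝ = foldr _+_ 0ℝ

-- A sampled subgraph is identified with its set S of included edges.
module _ {n : ℕ} (G : UncertainGraph n) where
  open UncertainGraph G

  Joins : Fin m → Fin n → Fin n → Set
  Joins e u v = ends e ≡ (u , v) ⊎ ends e ≡ (v , u)

  IsClique : Subset m → Subset n → Set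
  IsClique S C = ∀ u v → u ∈ C → v ∈ C → u ≢ v → ∃[ e ] (e ∈ S × Joins e u v)

  isClique? : ∀ C S → Dec (IsClique S C)
  isClique? C S = Finₚ.all? λ u → Finₚ.all? λ v →
    (u ∈? C) →-dec ((v ∈? C) →-dec (¬? (u Finₚ.≟ v) →-dec
      Finₚ.any? λ e → (e ∈? S) ×-dec
        (×ₚ.≡-dec Finₚ._≟_ Finₚ._≟_ (ends e) (u , v) ⊎-dec
         ×ₚ.≡-dec Finₚ._≟_ Finₚ._≟_ (ends e) (v , u))))

  Pr : Subset m → ℝ
  Pr S = Vector.foldr _*_ 1ℝ (λ e → if lookup S e then p e else (1ℝ - p e))

  clq : Subset n → ℝ
  clq C = sumℝ (map Pr (filter (isClique? C) (subsets m)))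

  IsαClique : ℝ → Subset n → Set
  IsαClique α C = α ≤ clq C

  IsαMaximalClique : ℝ → Subset n → Set
  IsαMaximalClique α M =
    IsαClique α M × ¬ (∃[ v ] (v ∉ M × IsαClique α (M ∪ ⁅ v ⁆)))

_Lists_ : ∀ {n} → List (Fin n) → Subset n → Set
L Lists M = Unique L × (∀ v → v ∈ˡ L ⇔ v ∈ M)

-- An algorithm is represented by its input-output behaviour and its step
-- count.  Its output may also contain lists that do not represent α-maximal
-- cliques.
record Algorithm (α : ℝ) : Set where
  field
    output      : ∀ {n} → UncertainGraph n → List (List (Fin n))
    time        : ∀ {n} → UncertainGraph n → ℕ
    outputs-all : ∀ {n} (G : UncertainGraph n) (M : Subset n) →
                  IsαMaximalClique G α M → ∃[ L ] (L ∈ˡ output G × L Lists M)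
    output-cost : ∀ {n} (G : UncertainGraph n) →
                  sum (map length (output G)) ℕ.≤ time G

-- The maximum of `time` over the inputs with n vertices is at least x.  Since
-- times are natural numbers, a supremum that is at least x is attained or
-- infinite, so some single input then takes time at least x.
WorstCase≥ : (∀ {n} → UncertainGraph n → ℕ) → ℕ → ℝ → Set
WorstCase≥ time n x = ∃[ G ] (x ≤ fromℕ (time {n} G))

WorstCaseΩ : (∀ {n} → UncertainGraph n → ℕ) → (ℕ → ℝ) → Set
WorstCaseΩ time f =
  ∃[ c ] (0ℝ < c × ∃[ N ] (∀ n → N ℕ.≤ n → WorstCase≥ time n (c * f n)))

{-# OPTIONS --safe #-}

-- In the complete graph with every edge probability equal to q, a set of s
-- vertices is a clique with probability q^(s(s-1)/2).  For k = ⌊n/2⌋ one can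
-- choose a rational q with q^(k(k+1)/2) < α ≤ q^(k(k-1)/2): take a power r^t
-- just above α, with r < 1 close to 1, and set q = r^j with j = ⌊t/(k(k-1)/2)⌋.
-- Then all k-subsets are α-maximal cliques, and listing them takes
-- k·C(n,k) ≥ (1/7)·√n·2ⁿ steps, by 16^k ≤ 4k·C(2k,k)².
module Submission where

open import Defs
open import Algebra.Bundles using (CommutativeRing)
open import Data.Bool using (Bool; true; if_then_else_; _∧_)
open import Data.Fin as Fin using (Fin; zero; suc)
import Data.Fin.Properties as Finₚ
open import Data.Fin.Subset using (Subset; inside; outside; ∣_∣; _∈_; _⊆_; _∪_; ⁅_⁆)
import Data.Fin.Subset.Properties as Subsetₚ
open import Data.Integer as ℤ using (+_; +[1+_]; -[1+_])
import Data.Integer.Properties as ℤₚ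
open import Data.List as List using (List; []; _∷_; length)
open import Data.List.Membership.Propositional using () renaming (_∈_ to _∈ˡ_)
import Data.List.Membership.Propositional.Properties as ∈ˡ
import Data.List.Properties as Listₚ
open import Data.List.Relation.Unary.All as All using ([]; _∷_)
import Data.List.Relation.Unary.All.Properties as Allₚ
open import Data.List.Relation.Unary.AllPairs using ([]; _∷_)
open import Data.List.Relation.Unary.Any using (here; there)
open import Data.List.Relation.Unary.Unique.Propositional using (Unique)
import Data.List.Relation.Unary.Unique.Propositional.Properties as Uniqueₚ
open import Data.Nat using (_^_)
open import Data.Nat as ℕ using (ℕ; zero; suc; z≤n; s≤s)
open import Data.Nat.Combinatorics
  using (nCk+nC[k+1]≡[n+1]C[k+1]; nCk≡nC[n∸k]; nCn≡1; k>n⇒nCk≡0)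
  renaming (_C_ to _choose_)
import Data.Nat.DivMod as ℕ/
open import Data.Nat.ListAction using (sum)
open import Data.Nat.ListAction.Properties using (sum-++)
import Data.Nat.Properties as ℕₚ
open import Data.Nat.Tactic.RingSolver using (solve-∀)
open import Data.Product as Product using (∃-syntax; _×_; _,_; proj₁; proj₂)
open import Data.Rational as ℚ using (ℚ; mkℚ; 0ℚ; 1ℚ; ½)
import Data.Rational.Properties as ℚₚ
open import Data.Rational.Solver using (module +-*-Solver)
open import Data.Rational.Unnormalised as ℚᵘ using (mkℚᵘ)
import Data.Rational.Unnormalised.Properties as ℚᵘₚ
open import Data.Sum using (_⊎_; inj₁; inj₂)
open import Data.Vec as Vec using (Vec; []; _∷_; lookup; here)
import Data.Vec.Functional as Vector
open import Data.Vec.Membership.Propositional using () renaming (_∈_ to _∈ᵛ_)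
import Data.Vec.Membership.Propositional.Properties as ∈ᵛ
import Data.Vec.Properties as Vecₚ
open import Data.Vec.Relation.Unary.All as Allᵛ using ([]) renaming (All to Allᵛ)
import Data.Vec.Relation.Unary.All.Properties as Allᵛₚ
open import Data.Vec.Relation.Unary.AllPairs using ([])
import Data.Vec.Relation.Unary.AllPairs.Properties as AllPairsᵛ
import Data.Vec.Relation.Unary.Any as Anyᵛ
import Data.Vec.Relation.Unary.Any.Properties as Anyᵛₚ
open import Data.Vec.Relation.Unary.Unique.Propositional using () renaming (Unique to Uniqueᵛ)
import Data.Vec.Relation.Unary.Unique.Propositional.Properties as Uniqueᵛₚ
open import Function using (_∘_; id; const)
open import Function.Bundles using (Equivalence)
open import Relation.Binary.Definitions using (tri<; tri≈; tri>)
open import Relation.Binary.PropositionalEquality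
open import Relation.Nullary using (¬_; yes; no; contradiction)
open import Relation.Unary using (Decidable)

open import Algebra.Properties.Monoid.Mult ℚₚ.+-0-monoid
  using () renaming (_×_ to _·_)
open import Algebra.Properties.Semiring.Exp
  (CommutativeRing.semiring ℚₚ.+-*-commutativeRing)
  using (^-assocʳ) renaming (_^_ to _^ℚ_)

open +-*-Solver using (solve; _:=_; _:+_; _:*_; :-_; _:-_; con)

-- The obstacle is that α is only a Cauchy sequence: it cannot be compared exactly with a rational,
-- and q cannot be taken as a root of α. So α is replaced by a rational approximation A with error
-- δ, and q must keep a distance δ from A on both sides. This threatens to be circular, since the
-- admissible δ depends on how densely the powers of r lie near α, while A is known only once δ is
-- fixed. The way out is a lower bound l > 0 of α, which comes with the hypothesis 0 < α. With r = 1
-- - x, one further factor r lowers a value near A by about x·A ≥ x·l, so δ = x·l/2 can be fixed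
-- from x and l alone. The window from A + δ down to A - δ is then crossed within two exponents: if
-- t is the last exponent found with r^t ≥ A + δ, then r^(t+2) < A - δ. What remains is arithmetic
-- of exponents, placing t and t + 2 between j·a and j·(a + k), where a = k(k-1)/2.

-- Inequalities and powers of rationals

0≤* : ∀ {p q} → 0ℚ ℚ.≤ p → 0ℚ ℚ.≤ q → 0ℚ ℚ.≤ p ℚ.* q
0≤* {p} {q} 0≤p 0≤q = ℚₚ.nonNegative⁻¹ (p ℚ.* q)
  {{ℚₚ.nonNeg*nonNeg⇒nonNeg p {{ℚ.nonNegative 0≤p}} q {{ℚ.nonNegative 0≤q}}}}

0<* : ∀ {p q} → 0ℚ ℚ.< p → 0ℚ ℚ.< q → 0ℚ ℚ.< p ℚ.* q
0<* {p} {q} 0<p 0<q = ℚₚ.positive⁻¹ (p ℚ.* q)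
  {{ℚₚ.pos*pos⇒pos p {{ℚ.positive 0<p}} q {{ℚ.positive 0<q}}}}

0≤+ : ∀ {p q} → 0ℚ ℚ.≤ p → 0ℚ ℚ.≤ q → 0ℚ ℚ.≤ p ℚ.+ q
0≤+ = ℚₚ.+-mono-≤

≤-by : ∀ {p q} d → 0ℚ ℚ.≤ d → p ℚ.+ d ≡ q → p ℚ.≤ q
≤-by {p} d 0≤d eq = subst₂ ℚ._≤_ (ℚₚ.+-identityʳ p) eq (ℚₚ.+-monoʳ-≤ p 0≤d)

<-by : ∀ {p q} d → 0ℚ ℚ.< d → p ℚ.+ d ≡ q → p ℚ.< q
<-by {p} d 0<d eq = subst₂ ℚ._<_ (ℚₚ.+-identityʳ p) eq (ℚₚ.+-monoʳ-< p 0<d)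

≤⇒0≤- : ∀ {p q} → p ℚ.≤ q → 0ℚ ℚ.≤ q ℚ.- p
≤⇒0≤- {p} {q} p≤q = subst (ℚ._≤ q ℚ.- p) (ℚₚ.+-inverseʳ p) (ℚₚ.+-monoˡ-≤ (ℚ.- p) p≤q)

<⇒0<- : ∀ {p q} → p ℚ.< q → 0ℚ ℚ.< q ℚ.- p
<⇒0<- {p} {q} p<q = subst (ℚ._< q ℚ.- p) (ℚₚ.+-inverseʳ p) (ℚₚ.+-monoˡ-< (ℚ.- p) p<q)

*-monoˡ-≤ : ∀ {r p q} → 0ℚ ℚ.≤ r → p ℚ.≤ q → r ℚ.* p ℚ.≤ r ℚ.* q
*-monoˡ-≤ {r} 0≤r = ℚₚ.*-monoˡ-≤-nonNeg r {{ℚ.nonNegative 0≤r}}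

*-monoˡ-< : ∀ {r p q} → 0ℚ ℚ.< r → p ℚ.< q → r ℚ.* p ℚ.< r ℚ.* q
*-monoˡ-< {r} 0<r = ℚₚ.*-monoʳ-<-pos r {{ℚ.positive 0<r}}

<⇒≱ : ∀ {p q} → p ℚ.< q → ¬ q ℚ.≤ p
<⇒≱ p<q q≤p = ℚₚ.<-irrefl refl (ℚₚ.<-≤-trans p<q q≤p)

0<½ : 0ℚ ℚ.< ½
0<½ = ℚₚ.positive⁻¹ ½

0≤1 : 0ℚ ℚ.≤ 1ℚ
0≤1 = ℚₚ.nonNegative⁻¹ 1ℚ

∣p∣≤r⇒p≤r : ∀ p {r} → ℚ.∣ p ∣ ℚ.≤ r → p ℚ.≤ r
∣p∣≤r⇒p≤r p@(mkℚ (+ _) _ _)    h = h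
∣p∣≤r⇒p≤r p@(mkℚ -[1+ _ ] _ _) h =
  ℚₚ.≤-trans (ℚₚ.<⇒≤ (ℚₚ.negative⁻¹ p)) (ℚₚ.≤-trans (ℚₚ.0≤∣p∣ p) h)

·-nonNeg : ∀ n {x} → 0ℚ ℚ.≤ x → 0ℚ ℚ.≤ n · x
·-nonNeg zero    0≤x = ℚₚ.≤-refl
·-nonNeg (suc n) 0≤x = 0≤+ 0≤x (·-nonNeg n 0≤x)

^-pos : ∀ {r} n → 0ℚ ℚ.< r → 0ℚ ℚ.< r ^ℚ n
^-pos zero    0<r = ℚₚ.positive⁻¹ 1ℚ
^-pos (suc n) 0<r = 0<* 0<r (^-pos n 0<r)

^-≤1 : ∀ {r} n → 0ℚ ℚ.< r → r ℚ.≤ 1ℚ → r ^ℚ n ℚ.≤ 1ℚ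
^-≤1     zero    0<r r≤1 = ℚₚ.≤-refl
^-≤1 {r} (suc n) 0<r r≤1 = ℚₚ.≤-trans (*-monoˡ-≤ (ℚₚ.<⇒≤ 0<r) (^-≤1 n 0<r r≤1))
  (ℚₚ.≤-trans (ℚₚ.≤-reflexive (ℚₚ.*-identityʳ r)) r≤1)

^-antimono : ∀ {r m n} → 0ℚ ℚ.< r → r ℚ.≤ 1ℚ → m ℕ.≤ n → r ^ℚ n ℚ.≤ r ^ℚ m
^-antimono {r} {n = n} 0<r r≤1 z≤n = ^-≤1 n 0<r r≤1
^-antimono 0<r r≤1 (s≤s m≤n) = *-monoˡ-≤ (ℚₚ.<⇒≤ 0<r) (^-antimono 0<r r≤1 m≤n)

-- The product (1 - x)(1 - n·x) exceeds 1 - (n+1)·x by x·(n·x) ≥ 0, and x ≤ 1 allows the induction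
-- hypothesis to be multiplied by 1 - x.
bernoulli : ∀ {x} n → 0ℚ ℚ.≤ x → x ℚ.≤ 1ℚ → 1ℚ ℚ.- n · x ℚ.≤ (1ℚ ℚ.- x) ^ℚ n
bernoulli     zero    0≤x x≤1 = ℚₚ.≤-refl
bernoulli {x} (suc n) 0≤x x≤1 = ℚₚ.≤-trans
  (≤-by (x ℚ.* (n · x)) (0≤* 0≤x (·-nonNeg n 0≤x))
    (solve 2 (λ x s → (con 1ℚ :- (x :+ s)) :+ (x :* s) := (con 1ℚ :- x) :* (con 1ℚ :- s))
      refl x (n · x)))
  (*-monoˡ-≤ (≤⇒0≤- x≤1) (bernoulli n 0≤x x≤1))

-- A division-free form of (1 - x)^n ≤ 1/(1 + n·x), which forces the powers to 0. In the induction
-- step, (1 + (n+1)·x)(1 - x) falls short of 1 + n·x by x² + x·(n·x).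
^-decay : ∀ {x} n → 0ℚ ℚ.≤ x → x ℚ.< 1ℚ → (1ℚ ℚ.+ n · x) ℚ.* (1ℚ ℚ.- x) ^ℚ n ℚ.≤ 1ℚ
^-decay     zero    0≤x x<1 = ℚₚ.≤-refl
^-decay {x} (suc n) 0≤x x<1 = ℚₚ.≤-trans
  (≤-by ((x ℚ.* x ℚ.+ x ℚ.* (n · x)) ℚ.* (1ℚ ℚ.- x) ^ℚ n)
    (0≤* (0≤+ (0≤* 0≤x 0≤x) (0≤* 0≤x (·-nonNeg n 0≤x)))
         (ℚₚ.<⇒≤ (^-pos n (<⇒0<- x<1))))
    (solve 3 (λ x s p → (con 1ℚ :+ (x :+ s)) :* ((con 1ℚ :- x) :* p) :+ (x :* x :+ x :* s) :* p
                        := (con 1ℚ :+ s) :* p)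
      refl x (n · x) ((1ℚ ℚ.- x) ^ℚ n)))
  (^-decay n 0≤x x<1)

-- Repeated halving, x = ε/2^n, instead of division by n + 1: the first copy of x and the other n
-- copies each fit into ε/2.
small-multiple : ∀ n ε → 0ℚ ℚ.< ε → ∃[ x ] (0ℚ ℚ.< x × x ℚ.≤ ε × suc n · x ℚ.≤ ε)
small-multiple zero    ε 0<ε = ε , 0<ε , ℚₚ.≤-refl , ℚₚ.≤-reflexive (ℚₚ.+-identityʳ ε)
small-multiple (suc n) ε 0<ε with small-multiple n (½ ℚ.* ε) (0<* 0<½ 0<ε)
... | x , 0<x , x≤ , nx≤ = x , 0<x ,
  ℚₚ.≤-trans x≤ (≤-by (½ ℚ.* ε) (ℚₚ.<⇒≤ (0<* 0<½ 0<ε)) halves) ,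
  ℚₚ.≤-trans (ℚₚ.+-mono-≤ x≤ nx≤) (ℚₚ.≤-reflexive halves)
  where
  halves : ½ ℚ.* ε ℚ.+ ½ ℚ.* ε ≡ ε
  halves = solve 1 (λ e → con ½ :* e :+ con ½ :* e := e) refl ε

toℚᵘ-/ : ∀ a k → ℚ.toℚᵘ (+ a ℚ./ suc k) ℚᵘ.≃ mkℚᵘ (+ a) k
toℚᵘ-/ a k = ℚₚ.toℚᵘ-fromℚᵘ (mkℚᵘ (+ a) k)

·-fraction : ∀ a k n → n · (+ a ℚ./ suc k) ≡ + (n ℕ.* a) ℚ./ suc k
·-fraction a k n = ℚₚ.toℚᵘ-injective (ℚᵘₚ.≃-trans (go n) (ℚᵘₚ.≃-sym (toℚᵘ-/ (n ℕ.* a) k)))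
  where
  y = + a ℚ./ suc k
  go : ∀ n → ℚ.toℚᵘ (n · y) ℚᵘ.≃ mkℚᵘ (+ (n ℕ.* a)) k
  go zero    = ℚᵘ.*≡* refl
  go (suc n) = ℚᵘₚ.≃-trans (ℚₚ.toℚᵘ-homo-+ y (n · y))
    (ℚᵘₚ.≃-trans (ℚᵘₚ.+-cong (toℚᵘ-/ a k) (go n))
      (ℚᵘ.*≡* (trans (cong (ℤ._* + suc k) (sym (ℤₚ.*-distribʳ-+ (+ suc k) (+ a) (+ (n ℕ.* a)))))
        (ℤₚ.*-assoc (+ (a ℕ.+ n ℕ.* a)) (+ suc k) (+ suc k)))))

archimedean : ∀ y → 0ℚ ℚ.< y → ∃[ n ] 1ℚ ℚ.≤ n · y
archimedean (mkℚ (+ zero) d c) (ℚ.*<* (ℤ.+<+ ()))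
archimedean (mkℚ -[1+ n ] d c) (ℚ.*<* ())
-- The witness is the denominator: that multiple of y is its numerator, which is at least 1.
archimedean y@(mkℚ +[1+ a ] d c) _ = suc d ,
  subst (1ℚ ℚ.≤_) (trans (sym (·-fraction (suc a) d (suc d))) (cong (suc d ·_) (ℚₚ.fromℚᵘ-toℚᵘ y)))
    (ℚₚ.toℚᵘ-cancel-≤ (ℚᵘₚ.≤-respʳ-≃ (ℚᵘₚ.≃-sym (toℚᵘ-/ (suc d ℕ.* suc a) d))
      (ℚᵘ.*≤* (subst₂ ℤ._≤_ (sym (ℤₚ.*-identityˡ (+ suc d))) (sym (ℤₚ.*-identityʳ (+ (suc d ℕ.* suc a))))
        (ℤ.+≤+ (ℕₚ.m≤m*n (suc d) (suc a)))))))

·-*-comm : ∀ n h x → n · (h ℚ.* x) ≡ h ℚ.* (n · x)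
·-*-comm zero    h x = sym (ℚₚ.*-zeroʳ h)
·-*-comm (suc n) h x = trans (cong (h ℚ.* x ℚ.+_) (·-*-comm n h x)) (sym (ℚₚ.*-distribˡ-+ h x (n · x)))

-- If n·(h x) ≥ 1 then (1 + n·x)·h > 1, so a power still at least h would violate `^-decay`.
^-eventually-< : ∀ {x h} → 0ℚ ℚ.< x → x ℚ.< 1ℚ → 0ℚ ℚ.< h → ∃[ n ] (1ℚ ℚ.- x) ^ℚ n ℚ.< h
^-eventually-< {x} {h} 0<x x<1 0<h with archimedean (h ℚ.* x) (0<* 0<h 0<x)
... | n , 1≤nhx = n , ℚₚ.≰⇒> λ h≤ → <⇒≱ 1<[1+nx]h (ℚₚ.≤-trans
    (*-monoˡ-≤ (0≤+ 0≤1 (·-nonNeg n (ℚₚ.<⇒≤ 0<x))) h≤) (^-decay n (ℚₚ.<⇒≤ 0<x) x<1))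
  where
  1<[1+nx]h : 1ℚ ℚ.< (1ℚ ℚ.+ n · x) ℚ.* h
  1<[1+nx]h = ℚₚ.≤-<-trans (ℚₚ.≤-trans 1≤nhx (ℚₚ.≤-reflexive (·-*-comm n h x)))
    (<-by h 0<h (solve 2 (λ h s → h :* s :+ h := (con 1ℚ :+ s) :* h) refl h (n · x)))

-- A rational edge probability separating sets of k and k + 1 vertices

-- The search descends from the failing index, so the first success that it meets is directly
-- followed by a failure. It locates the exponent at which the powers of r drop below A + δ.
last-before : ∀ {p} {P : ℕ → Set p} → Decidable P → ∀ m d → P m → ¬ P (d ℕ.+ m) →
  ∃[ t ] (m ℕ.≤ t × P t × ¬ P (suc t))
last-before P? m zero    Pm ¬P = contradiction Pm ¬P
last-before P? m (suc d) Pm ¬P with P? (d ℕ.+ m)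
... | yes Pd = d ℕ.+ m , ℕₚ.m≤n+m m d , Pd , ¬P
... | no ¬Pd = last-before P? m d Pm ¬Pd

-- j = ⌊t/a⌋; since t ≥ a(a+1), the exponent increment jk exceeds the rounding loss t − ja < a by 2.
scaled-exponents : ∀ a k t → 1 ℕ.≤ a → 1 ℕ.≤ k → a ℕ.* suc a ℕ.≤ t →
  ∃[ j ] (j ℕ.* a ℕ.≤ t × 2 ℕ.+ t ℕ.≤ j ℕ.* (a ℕ.+ k))
scaled-exponents a@(suc _) k t _ 1≤k a*[1+a]≤t = j , j*a≤t , (begin
  2 ℕ.+ t                       ≡⟨ cong (2 ℕ.+_) (ℕ/.m≡m%n+[m/n]*n t a) ⟩
  2 ℕ.+ (t ℕ/.% a ℕ.+ j ℕ.* a)  ≤⟨ ℕₚ.+-monoˡ-≤ (j ℕ.* a) (s≤s (ℕ/.m%n<n t a)) ⟩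
  suc a ℕ.+ j ℕ.* a             ≤⟨ ℕₚ.+-monoˡ-≤ (j ℕ.* a) a<j ⟩
  j ℕ.+ j ℕ.* a                 ≤⟨ ℕₚ.+-monoˡ-≤ (j ℕ.* a) (ℕₚ.m≤m*n j k {{ℕ.>-nonZero 1≤k}}) ⟩
  j ℕ.* k ℕ.+ j ℕ.* a           ≡⟨ ℕₚ.+-comm (j ℕ.* k) (j ℕ.* a) ⟩
  j ℕ.* a ℕ.+ j ℕ.* k           ≡⟨ ℕₚ.*-distribˡ-+ j a k ⟨
  j ℕ.* (a ℕ.+ k)               ∎)
  where
  open ℕₚ.≤-Reasoning
  j : ℕ
  j = t ℕ/./ a
  j*a≤t : j ℕ.* a ℕ.≤ t
  j*a≤t = ℕ/.m/n*n≤m t a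
  a<j : a ℕ.< j
  a<j = subst (ℕ._≤ j) (ℕ/.m*n/n≡m (suc a) a)
    (ℕ/./-monoˡ-≤ a (subst (ℕ._≤ t) (ℕₚ.*-comm a (suc a)) a*[1+a]≤t))

-- The margin δ is built from x and l rather than from A, so that a caller can fix it before
-- approximating α. The bound on (a(a+1) + 1)·x keeps r so close to 1 that the crossing exponent t
-- is at least a(a+1), as `scaled-exponents` demands.
separating-base : ∀ {A l η} a k → 1 ℕ.≤ a → 1 ℕ.≤ k → 0ℚ ℚ.< l → 0ℚ ℚ.< η →
  l ℚ.≤ A → A ℚ.+ η ℚ.≤ 1ℚ → ∀ {x} → 0ℚ ℚ.< x → suc (a ℕ.* suc a) · x ℚ.≤ η → x ℚ.≤ η →
  let δ = ½ ℚ.* (x ℚ.* l) in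
  ∃[ q ] (0ℚ ℚ.< q × q ℚ.≤ 1ℚ × A ℚ.+ δ ℚ.≤ q ^ℚ a × q ^ℚ (a ℕ.+ k) ℚ.< A ℚ.- δ)
separating-base {A} {l} {η} a k 1≤a 1≤k 0<l 0<η l≤A A+η≤1 {x} 0<x Tx≤η x≤η =
  q , ^-pos j 0<r , ^-≤1 j 0<r r≤1 ,
  subst (A ℚ.+ δ ℚ.≤_) (sym (^-assocʳ r j a)) (ℚₚ.≤-trans A+δ≤rᵗ (^-antimono 0<r r≤1 ja≤t)) ,
  subst (ℚ._< A ℚ.- δ) (sym (^-assocʳ r j (a ℕ.+ k)))
    (ℚₚ.≤-<-trans (^-antimono 0<r r≤1 t+2≤) r²⁺ᵗ<)
  where
  T : ℕ
  T = a ℕ.* suc a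
  δ r : ℚ
  δ = ½ ℚ.* (x ℚ.* l)
  r = 1ℚ ℚ.- x
  0≤x = ℚₚ.<⇒≤ 0<x
  0<A = ℚₚ.<-≤-trans 0<l l≤A
  η<1 : η ℚ.< 1ℚ
  η<1 = ℚₚ.<-≤-trans (<-by A 0<A (ℚₚ.+-comm η A)) A+η≤1
  x<1 = ℚₚ.≤-<-trans x≤η η<1
  A≤1 : A ℚ.≤ 1ℚ
  A≤1 = ℚₚ.≤-trans (≤-by η (ℚₚ.<⇒≤ 0<η) refl) A+η≤1
  0<δ : 0ℚ ℚ.< δ
  0<δ = 0<* 0<½ (0<* 0<x 0<l)
  δ≤x : δ ℚ.≤ x
  δ≤x = ≤-by (½ ℚ.* x ℚ.+ ½ ℚ.* (x ℚ.* (1ℚ ℚ.- l)))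
    (0≤+ (0≤* (ℚₚ.<⇒≤ 0<½) 0≤x)
         (0≤* (ℚₚ.<⇒≤ 0<½) (0≤* 0≤x (≤⇒0≤- (ℚₚ.≤-trans l≤A A≤1)))))
    (solve 2 (λ x l → con ½ :* (x :* l) :+ (con ½ :* x :+ con ½ :* (x :* (con 1ℚ :- l))) := x) refl x l)
  0<r : 0ℚ ℚ.< r
  0<r = <⇒0<- x<1
  r≤1 : r ℚ.≤ 1ℚ
  r≤1 = ≤-by x 0≤x (solve 1 (λ x → (con 1ℚ :- x) :+ x := con 1ℚ) refl x)
  P : ℕ → Set
  P t = A ℚ.+ δ ℚ.≤ r ^ℚ t
  P? : Decidable P
  P? t = (A ℚ.+ δ) ℚₚ.≤? (r ^ℚ t)
  -- Since δ ≤ x, A + δ ≤ (1 - η) + x ≤ 1 - T·x; Bernoulli does the rest.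
  PT : P T
  PT = ℚₚ.≤-trans
    (≤-by (((1ℚ ℚ.- (A ℚ.+ η)) ℚ.+ (η ℚ.- (x ℚ.+ T · x))) ℚ.+ (x ℚ.- δ))
      (0≤+ (0≤+ (≤⇒0≤- A+η≤1) (≤⇒0≤- Tx≤η)) (≤⇒0≤- δ≤x))
      (solve 5 (λ A d e x s → (A :+ d) :+ (((con 1ℚ :- (A :+ e)) :+ (e :- (x :+ s))) :+ (x :- d))
                              := con 1ℚ :- s)
        refl A δ η x (T · x)))
    (bernoulli T 0≤x (ℚₚ.<⇒≤ x<1))
  small : ∃[ u ] r ^ℚ u ℚ.< A ℚ.+ δ
  small = ^-eventually-< 0<x x<1 (ℚₚ.+-mono-< 0<A 0<δ)
  u = proj₁ small
  last : ∃[ t ] (T ℕ.≤ t × P t × ¬ P (suc t))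
  last = last-before P? T u PT λ Pu →
    <⇒≱ (proj₂ small) (ℚₚ.≤-trans Pu (^-antimono 0<r r≤1 (ℕₚ.m≤m+n u T)))
  t = proj₁ last
  A+δ≤rᵗ : A ℚ.+ δ ℚ.≤ r ^ℚ t
  A+δ≤rᵗ = proj₁ (proj₂ (proj₂ last))
  exps = scaled-exponents a k t 1≤a 1≤k (proj₁ (proj₂ last))
  j = proj₁ exps
  ja≤t = proj₁ (proj₂ exps)
  t+2≤ = proj₂ (proj₂ exps)
  q = r ^ℚ j
  -- The failure at t + 1 only gives r^(t+1) < A + δ. One more factor 1 - x removes at least x·A ≥
  -- x·l = 2δ, which carries the power below A - δ.
  r²⁺ᵗ< : r ^ℚ (2 ℕ.+ t) ℚ.< A ℚ.- δ
  r²⁺ᵗ< = ℚₚ.<-≤-trans (*-monoˡ-< 0<r (ℚₚ.≰⇒> (proj₂ (proj₂ (proj₂ last)))))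
    (≤-by (x ℚ.* (A ℚ.- l) ℚ.+ x ℚ.* δ)
      (0≤+ (0≤* 0≤x (≤⇒0≤- l≤A)) (0≤* 0≤x (ℚₚ.<⇒≤ 0<δ)))
      (solve 3 (λ A x l → let d = con ½ :* (x :* l) in
          (con 1ℚ :- x) :* (A :+ d) :+ (x :* (A :- l) :+ x :* d) := A :- d)
        refl A x l))

module _ (α : ℝ) {A δ : ℚ} {N : ℕ} (near : ∀ i → N ℕ.≤ i → ℚ.∣ seq α i ℚ.- A ∣ ℚ.≤ δ) where

  near⇒≤ : ∀ {c} → A ℚ.+ δ ℚ.≤ c → α ≤ fromℚ c
  near⇒≤ {c} A+δ≤c ε 0<ε = N , λ i N≤i → begin
    seq α i                ≡⟨ solve 2 (λ s A → s := A :+ (s :- A)) refl (seq α i) A ⟩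
    A ℚ.+ (seq α i ℚ.- A)  ≤⟨ ℚₚ.+-monoʳ-≤ A (∣p∣≤r⇒p≤r (seq α i ℚ.- A) (near i N≤i)) ⟩
    A ℚ.+ δ                ≤⟨ A+δ≤c ⟩
    c                      ≤⟨ ≤-by ε (ℚₚ.<⇒≤ 0<ε) refl ⟩
    c ℚ.+ ε                ∎
    where open ℚₚ.≤-Reasoning

  -- The order on reals tolerates an arbitrary ε, so the gap must be strict: with a rational m
  -- between c and A - δ, the choice ε = m - c would eventually force the terms of α down to m, yet
  -- they stay at least A - δ.
  near⇒≰ : ∀ {c} → c ℚ.< A ℚ.- δ → ¬ α ≤ fromℚ c
  near⇒≰ {c} c<A-δ α≤c with ℚₚ.<-dense c<A-δ
  ... | m , c<m , m<A-δ with α≤c (m ℚ.- c) (<⇒0<- c<m)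
  ...   | M , α≤m = <⇒≱ m<A-δ (begin
    A ℚ.- δ                    ≤⟨ ≤-by (δ ℚ.- (A ℚ.- seq α i)) (≤⇒0≤- A-αᵢ≤δ)
                                    (solve 3 (λ A d s → (A :- d) :+ (d :- (A :- s)) := s) refl A δ (seq α i)) ⟩
    seq α i          ≤⟨ α≤m i (ℕₚ.m≤n⊔m N M) ⟩
    c ℚ.+ (m ℚ.- c)  ≡⟨ solve 2 (λ c m → c :+ (m :- c) := m) refl c m ⟩
    m                ∎)
    where
    open ℚₚ.≤-Reasoning
    i : ℕ
    i = N ℕ.⊔ M
    A-αᵢ≤δ : A ℚ.- seq α i ℚ.≤ δ
    A-αᵢ≤δ = ∣p∣≤r⇒p≤r (A ℚ.- seq α i) (subst (ℚ._≤ δ)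
      (trans (sym (ℚₚ.∣-p∣≡∣p∣ (seq α i ℚ.- A)))
        (cong ℚ.∣_∣ (solve 2 (λ s A → :- (s :- A) := A :- s) refl (seq α i) A)))
      (near i (ℕₚ.m≤m⊔n N M)))

-- Here a is the number of pairs in a k-set and k the number of pairs that one further vertex adds.
-- The choices are made in the order x (from η and a), δ (from x and l), then the index N and A =
-- `seq α N`.
separating-probability : ∀ α → 0ℝ < α → α < 1ℝ → ∀ a k → 1 ℕ.≤ a → 1 ℕ.≤ k →
  ∃[ q ] (0ℚ ℚ.< q × q ℚ.≤ 1ℚ × α ≤ fromℚ (q ^ℚ a) ×
          (∀ b → a ℕ.+ k ℕ.≤ b → ¬ α ≤ fromℚ (q ^ℚ b)))
separating-probability α (l , 0<l , K , l≤α) (η , 0<η , L , α≤1-η) a k 1≤a 1≤k =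
  let x , 0<x , x≤η , Tx≤η = small-multiple (a ℕ.* suc a) η 0<η
  in fromSlack x 0<x x≤η Tx≤η
  where
  Goal : Set
  Goal = ∃[ q ] (0ℚ ℚ.< q × q ℚ.≤ 1ℚ × α ≤ fromℚ (q ^ℚ a) ×
                (∀ b → a ℕ.+ k ℕ.≤ b → ¬ α ≤ fromℚ (q ^ℚ b)))
  fromSlack : ∀ x → 0ℚ ℚ.< x → x ℚ.≤ η → suc (a ℕ.* suc a) · x ℚ.≤ η → Goal
  fromSlack x 0<x x≤η Tx≤η = fromModulus (cauchy α δ (0<* {½} {x ℚ.* l} 0<½ (0<* {x} {l} 0<x 0<l)))
    where
    δ : ℚ
    δ = ½ ℚ.* (x ℚ.* l)
    fromModulus : ∃[ M ] (∀ i j → M ℕ.≤ i → M ℕ.≤ j → ℚ.∣ seq α i ℚ.- seq α j ∣ ℚ.≤ δ) → Goal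
    fromModulus (M , close) = fromBase (separating-base {A} {l} {η} a k 1≤a 1≤k 0<l 0<η
      (subst (ℚ._≤ A) (ℚₚ.+-identityˡ l) (l≤α N (ℕₚ.≤-trans (ℕₚ.m≤m⊔n K L) (ℕₚ.m≤m⊔n (K ℕ.⊔ L) M))))
      (α≤1-η N (ℕₚ.≤-trans (ℕₚ.m≤n⊔m K L) (ℕₚ.m≤m⊔n (K ℕ.⊔ L) M)))
      {x} 0<x Tx≤η x≤η)
      where
      -- Late enough for l ≤ A, for A + η ≤ 1, and for all later terms to stay within δ of A.
      N : ℕ
      N = K ℕ.⊔ L ℕ.⊔ M
      A : ℚ
      A = seq α N
      near : ∀ i → N ℕ.≤ i → ℚ.∣ seq α i ℚ.- A ∣ ℚ.≤ δ
      near i N≤i = close i N (ℕₚ.≤-trans (ℕₚ.m≤n⊔m (K ℕ.⊔ L) M) N≤i) (ℕₚ.m≤n⊔m (K ℕ.⊔ L) M)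
      fromBase : ∃[ q ] (0ℚ ℚ.< q × q ℚ.≤ 1ℚ × A ℚ.+ δ ℚ.≤ q ^ℚ a × q ^ℚ (a ℕ.+ k) ℚ.< A ℚ.- δ) → Goal
      fromBase (q , 0<q , q≤1 , A+δ≤ , <A-δ) = q , 0<q , q≤1 , near⇒≤ α {A} {δ} {N} near A+δ≤ ,
        λ b a+k≤b → near⇒≰ α {A} {δ} {N} near (ℚₚ.≤-<-trans (^-antimono {q} 0<q q≤1 a+k≤b) <A-δ)

-- Probability that a sample contains a prescribed edge set

∑ : ∀ {A : Set} → (A → ℚ) → List A → ℚ
∑ f []       = 0ℚ
∑ f (x ∷ xs) = f x ℚ.+ ∑ f xs

∑-++ : ∀ {A : Set} (f : A → ℚ) xs ys → ∑ f (xs List.++ ys) ≡ ∑ f xs ℚ.+ ∑ f ys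
∑-++ f []       ys = sym (ℚₚ.+-identityˡ (∑ f ys))
∑-++ f (x ∷ xs) ys = trans (cong (f x ℚ.+_) (∑-++ f xs ys)) (sym (ℚₚ.+-assoc (f x) (∑ f xs) (∑ f ys)))

∑-map : ∀ {A B : Set} (f : B → ℚ) (g : A → B) xs → ∑ f (List.map g xs) ≡ ∑ (f ∘ g) xs
∑-map f g []       = refl
∑-map f g (x ∷ xs) = cong (f (g x) ℚ.+_) (∑-map f g xs)

∑-*ˡ : ∀ {A : Set} c (f : A → ℚ) xs → ∑ (λ x → c ℚ.* f x) xs ≡ c ℚ.* ∑ f xs
∑-*ˡ c f []       = sym (ℚₚ.*-zeroʳ c)
∑-*ˡ c f (x ∷ xs) = trans (cong (c ℚ.* f x ℚ.+_) (∑-*ˡ c f xs)) (sym (ℚₚ.*-distribˡ-+ c (f x) (∑ f xs)))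

∑-zero : ∀ {A : Set} (xs : List A) → ∑ (λ _ → 0ℚ) xs ≡ 0ℚ
∑-zero []       = refl
∑-zero (x ∷ xs) = trans (ℚₚ.+-identityˡ _) (∑-zero xs)

module _ (q : ℚ) where

  edgeWeight : Bool → ℚ
  edgeWeight s = if s then q else 1ℚ ℚ.- q

  weight : ∀ {m} → Subset m → ℚ
  weight []      = 1ℚ
  weight (s ∷ S) = edgeWeight s ℚ.* weight S

  -- The weight of S cut off to 0 unless R ⊆ S. Defining it coordinate by coordinate makes the sum
  -- over all S factor.
  weight⊇ : ∀ {m} → Subset m → Subset m → ℚ
  weight⊇ []          []            = 1ℚ
  weight⊇ (inside ∷ R) (inside ∷ S)  = q ℚ.* weight⊇ R S
  weight⊇ (inside ∷ R) (outside ∷ S) = 0ℚ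
  weight⊇ (outside ∷ R) (s ∷ S)      = edgeWeight s ℚ.* weight⊇ R S

  weight⊇-⊆ : ∀ {m} (R S : Subset m) → R ⊆ S → weight⊇ R S ≡ weight S
  weight⊇-⊆ []            []            R⊆S = refl
  weight⊇-⊆ (inside ∷ R)  (inside ∷ S)  R⊆S = cong (q ℚ.*_) (weight⊇-⊆ R S (Subsetₚ.drop-∷-⊆ R⊆S))
  weight⊇-⊆ (inside ∷ R)  (outside ∷ S) R⊆S = contradiction (R⊆S here) λ ()
  weight⊇-⊆ (outside ∷ R) (s ∷ S)       R⊆S =
    cong (edgeWeight s ℚ.*_) (weight⊇-⊆ R S (Subsetₚ.drop-∷-⊆ R⊆S))

  weight⊇-⊈ : ∀ {m} (R S : Subset m) → ¬ R ⊆ S → weight⊇ R S ≡ 0ℚ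
  weight⊇-⊈ []            []            R⊈S = contradiction (λ ()) R⊈S
  weight⊇-⊈ (inside ∷ R)  (inside ∷ S)  R⊈S =
    trans (cong (q ℚ.*_) (weight⊇-⊈ R S (R⊈S ∘ Subsetₚ.s⊆s))) (ℚₚ.*-zeroʳ q)
  weight⊇-⊈ (inside ∷ R)  (outside ∷ S) R⊈S = refl
  weight⊇-⊈ (outside ∷ R) (s ∷ S)       R⊈S =
    trans (cong (edgeWeight s ℚ.*_) (weight⊇-⊈ R S (R⊈S ∘ Subsetₚ.out⊆)))
      (ℚₚ.*-zeroʳ (edgeWeight s))

  -- Each coordinate in R contributes the factor q + 0, each other one q + (1 - q) = 1.
  ∑-weight⊇ : ∀ {m} (R : Subset m) → ∑ (weight⊇ R) (subsets m) ≡ q ^ℚ ∣ R ∣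
  ∑-weight⊇ [] = refl
  ∑-weight⊇ {suc m} (r ∷ R) = trans
    (trans (∑-++ (weight⊇ (r ∷ R)) (List.map (inside ∷_) (subsets m)) _)
      (cong₂ ℚ._+_ (∑-map (weight⊇ (r ∷ R)) (inside ∷_) (subsets m))
                   (∑-map (weight⊇ (r ∷ R)) (outside ∷_) (subsets m))))
    (split r)
    where
    split : ∀ r → ∑ (λ S → weight⊇ (r ∷ R) (inside ∷ S)) (subsets m) ℚ.+
                  ∑ (λ S → weight⊇ (r ∷ R) (outside ∷ S)) (subsets m) ≡ q ^ℚ ∣ r ∷ R ∣
    split inside = trans (cong₂ ℚ._+_ (∑-*ˡ q (weight⊇ R) (subsets m)) (∑-zero (subsets m)))
      (trans (ℚₚ.+-identityʳ _) (cong (q ℚ.*_) (∑-weight⊇ R)))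
    split outside = trans
      (cong₂ ℚ._+_ (∑-*ˡ q (weight⊇ R) (subsets m)) (∑-*ˡ (1ℚ ℚ.- q) (weight⊇ R) (subsets m)))
      (trans (solve 2 (λ q x → q :* x :+ (con 1ℚ :- q) :* x := x) refl q (∑ (weight⊇ R) (subsets m)))
        (∑-weight⊇ R))

-- Edges of the complete graph and edges inside a vertex set

triangular : ℕ → ℕ
triangular zero    = 0
triangular (suc n) = n ℕ.+ triangular n

triangular-mono : ∀ {m n} → m ℕ.≤ n → triangular m ℕ.≤ triangular n
triangular-mono z≤n       = z≤n
triangular-mono (s≤s m≤n) = ℕₚ.+-mono-≤ m≤n (triangular-mono m≤n)

-- The pairs at vertex 0 come first, matching the recursion of `triangular`; positions in this
-- vector serve as the edge names.
pairs : ∀ n → Vec (Fin n × Fin n) (triangular n)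
pairs zero    = []
pairs (suc n) =
  Vec.map (λ j → zero , suc j) (Vec.allFin n) Vec.++ Vec.map (Product.map suc suc) (pairs n)

pairs-oriented : ∀ n → Allᵛ (λ (u , v) → u Fin.< v) (pairs n)
pairs-oriented zero    = []
pairs-oriented (suc n) = Allᵛₚ.++⁺
  (Allᵛₚ.map⁺ (Allᵛₚ.tabulate⁺ λ _ → s≤s z≤n))
  (Allᵛₚ.map⁺ (Allᵛ.map s≤s (pairs-oriented n)))

pairs-unique : ∀ n → Uniqueᵛ (pairs n)
pairs-unique zero    = []
pairs-unique (suc n) = AllPairsᵛ.++⁺
  (Uniqueᵛₚ.map⁺ (λ { refl → refl }) (Uniqueᵛₚ.tabulate⁺ id))
  (Uniqueᵛₚ.map⁺
    (λ eq → cong₂ _,_ (Finₚ.suc-injective (cong proj₁ eq)) (Finₚ.suc-injective (cong proj₂ eq)))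
    (pairs-unique n))
  (Allᵛₚ.map⁺ (Allᵛₚ.tabulate⁺ λ _ → Allᵛₚ.map⁺ (Allᵛₚ.lookup⁻ λ _ ())))

∈-pairs : ∀ {n} {u v : Fin n} → u Fin.< v → (u , v) ∈ᵛ pairs n
∈-pairs {suc n} {zero}  {suc v} _         = ∈ᵛ.∈-++⁺ˡ (∈ᵛ.∈-map⁺ _ (∈ᵛ.∈-allFin⁺ v))
∈-pairs {suc n} {suc u} {suc v} (s≤s u<v) =
  ∈ᵛ.∈-++⁺ʳ (Vec.map _ (Vec.allFin n)) (∈ᵛ.∈-map⁺ _ (∈-pairs u<v))

bothIn : ∀ {n} → Subset n → Fin n × Fin n → Bool
bothIn C (u , v) = lookup C u ∧ lookup C v

-- This turns the clique event into an inclusion: C is a clique in the sample S exactly when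
-- `innerEdges C` ⊆ S.
innerEdges : ∀ {n} → Subset n → Subset (triangular n)
innerEdges {n} C = Vec.map (bothIn C) (pairs n)

∣++∣ : ∀ {m n} (p : Subset m) (q : Subset n) → ∣ p Vec.++ q ∣ ≡ ∣ p ∣ ℕ.+ ∣ q ∣
∣++∣ []            q = refl
∣++∣ (inside ∷ p)  q = cong suc (∣++∣ p q)
∣++∣ (outside ∷ p) q = ∣++∣ p q

∣innerEdges∣ : ∀ {n} (C : Subset n) → ∣ innerEdges C ∣ ≡ triangular ∣ C ∣
∣innerEdges∣ []          = refl
∣innerEdges∣ {suc n} (c ∷ C) = begin
  ∣ innerEdges (c ∷ C) ∣
    ≡⟨ cong ∣_∣ (Vecₚ.map-++ (bothIn (c ∷ C)) (Vec.map _ (Vec.allFin n)) _) ⟩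
  ∣ Vec.map (bothIn (c ∷ C)) (Vec.map (λ j → zero , suc j) (Vec.allFin n)) Vec.++
    Vec.map (bothIn (c ∷ C)) (Vec.map (Product.map suc suc) (pairs n)) ∣
    ≡⟨ cong₂ (λ p q → ∣ p Vec.++ q ∣) (sym (Vecₚ.map-∘ _ _ (Vec.allFin n)))
         (sym (Vecₚ.map-∘ _ _ (pairs n))) ⟩
  ∣ Vec.map (λ j → c ∧ lookup C j) (Vec.allFin n) Vec.++ innerEdges C ∣
    ≡⟨ ∣++∣ (Vec.map (λ j → c ∧ lookup C j) (Vec.allFin n)) (innerEdges C) ⟩
  ∣ Vec.map (λ j → c ∧ lookup C j) (Vec.allFin n) ∣ ℕ.+ ∣ innerEdges C ∣
    ≡⟨ cong (∣ Vec.map (λ j → c ∧ lookup C j) (Vec.allFin n) ∣ ℕ.+_) (∣innerEdges∣ C) ⟩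
  ∣ Vec.map (λ j → c ∧ lookup C j) (Vec.allFin n) ∣ ℕ.+ triangular ∣ C ∣
    ≡⟨ star c ⟩
  triangular ∣ c ∷ C ∣ ∎
  where
  open ≡-Reasoning
  -- The edges at vertex 0 that stay inside the set: one for each element of C if 0 belongs to the
  -- set, otherwise none.
  star : ∀ c → ∣ Vec.map (λ j → c ∧ lookup C j) (Vec.allFin n) ∣ ℕ.+ triangular ∣ C ∣ ≡ triangular ∣ c ∷ C ∣
  star inside  = cong (λ p → ∣ p ∣ ℕ.+ triangular ∣ C ∣) (Vecₚ.map-lookup-allFin C)
  star outside = cong (ℕ._+ triangular ∣ C ∣)
    (trans (cong ∣_∣ (Vecₚ.map-const (Vec.allFin n) outside)) (Subsetₚ.∣⊥∣≡0 n))

∈-innerEdges⁺ : ∀ {n} (C : Subset n) e →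
  proj₁ (lookup (pairs n) e) ∈ C → proj₂ (lookup (pairs n) e) ∈ C → e ∈ innerEdges C
∈-innerEdges⁺ {n} C e u∈C v∈C = Vecₚ.lookup⇒[]= e _
  (trans (Vecₚ.lookup-map e (bothIn C) (pairs n))
    (cong₂ _∧_ (Vecₚ.[]=⇒lookup u∈C) (Vecₚ.[]=⇒lookup v∈C)))

∈-innerEdges⁻ : ∀ {n} (C : Subset n) e → e ∈ innerEdges C →
  proj₁ (lookup (pairs n) e) ∈ C × proj₂ (lookup (pairs n) e) ∈ C
∈-innerEdges⁻ {n} C e e∈ = conj _ _ refl refl
  (trans (sym (Vecₚ.lookup-map e (bothIn C) (pairs n))) (Vecₚ.[]=⇒lookup e∈))
  where
  conj : ∀ x y → x ≡ lookup C (proj₁ (lookup (pairs n) e)) → y ≡ lookup C (proj₂ (lookup (pairs n) e)) →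
         x ∧ y ≡ true →
         proj₁ (lookup (pairs n) e) ∈ C × proj₂ (lookup (pairs n) e) ∈ C
  conj true true x≡ y≡ _ = Vecₚ.lookup⇒[]= _ C (sym x≡) , Vecₚ.lookup⇒[]= _ C (sym y≡)

-- Clique probabilities in the complete graph with equal edge probabilities

module _ (n : ℕ) (q : ℚ) (0<q : 0ℚ ℚ.< q) (q≤1 : q ℚ.≤ 1ℚ) where

  complete : UncertainGraph n
  complete = record
    { m        = triangular n
    ; ends     = lookup (pairs n)
    ; oriented = Allᵛₚ.lookup⁺ (pairs-oriented n)
    ; simple   = λ {e} {f} → Uniqueᵛₚ.lookup-injective (pairs-unique n) e f
    ; p        = λ _ → fromℚ q
    ; p>0      = λ _ → q , 0<q , 0 , λ _ _ → ℚₚ.≤-reflexive (ℚₚ.+-identityˡ q)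
    ; p≤1      = λ _ ε 0<ε → 0 , λ _ _ → ℚₚ.≤-trans q≤1 (≤-by ε (ℚₚ.<⇒≤ 0<ε) refl)
    }

  edge-between : ∀ {u v} → u Fin.< v → ∃[ e ] lookup (pairs n) e ≡ (u , v)
  edge-between u<v = Anyᵛ.index uv∈ , sym (Anyᵛₚ.lookup-index uv∈)
    where uv∈ = ∈-pairs u<v

  isClique⇒ : ∀ {C} {S : Subset (triangular n)} → IsClique complete S C → innerEdges C ⊆ S
  isClique⇒ {C} {S} clique {e} e∈ with ∈-innerEdges⁻ C e e∈
  ... | u∈C , v∈C with clique _ _ u∈C v∈C (Finₚ.<⇒≢ (UncertainGraph.oriented complete e))
  ...   | f , f∈S , inj₁ eq = subst (_∈ S) (UncertainGraph.simple complete eq) f∈S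
  -- An edge with the reversed ends would contradict the orientation from smaller to larger vertex.
  ...   | f , f∈S , inj₂ eq = contradiction
    (subst₂ Fin._<_ (cong proj₁ eq) (cong proj₂ eq) (UncertainGraph.oriented complete f))
    (Finₚ.<-asym (UncertainGraph.oriented complete e))

  isClique⇐ : ∀ {C} {S : Subset (triangular n)} → innerEdges C ⊆ S → IsClique complete S C
  isClique⇐ {C} {S} inner⊆S u v u∈C v∈C u≢v with Finₚ.<-cmp u v
  ... | tri≈ _ u≡v _ = contradiction u≡v u≢v
  ... | tri< u<v _ _ with edge-between u<v
  ...   | e , eq = e , inner⊆S (∈-innerEdges⁺ C e
            (subst (_∈ C) (sym (cong proj₁ eq)) u∈C) (subst (_∈ C) (sym (cong proj₂ eq)) v∈C)) , inj₁ eq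
  isClique⇐ {C} {S} inner⊆S u v u∈C v∈C u≢v | tri> _ _ v<u with edge-between v<u
  ...   | e , eq = e , inner⊆S (∈-innerEdges⁺ C e
            (subst (_∈ C) (sym (cong proj₁ eq)) v∈C) (subst (_∈ C) (sym (cong proj₂ eq)) u∈C)) , inj₂ eq

  -- All edge probabilities are constant sequences and the operations are pointwise, so every term
  -- is already the exact rational and no limit is involved.
  seq-Pr : ∀ (S : Subset (triangular n)) i → seq (Pr complete S) i ≡ weight q S
  seq-Pr S i = go S
    where
    go : ∀ {m} (S : Subset m) → seq (Vector.foldr _*_ 1ℝ
           (λ e → if lookup S e then fromℚ q else (1ℝ - fromℚ q))) i ≡ weight q S
    go []            = refl
    go (inside ∷ S)  = cong (q ℚ.*_) (go S)
    go (outside ∷ S) = cong ((1ℚ ℚ.- q) ℚ.*_) (go S)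

  -- The filter can be traded for `weight⊇` because the discarded samples are exactly those of
  -- weight 0.
  seq-sum-filter : ∀ {P : Subset (triangular n) → Set} (P? : Decidable P) R →
    (∀ {S} → P S → R ⊆ S) → (∀ {S} → R ⊆ S → P S) → ∀ i Ss →
    seq (sumℝ (List.map (Pr complete) (List.filter P? Ss))) i ≡ ∑ (weight⊇ q R) Ss
  seq-sum-filter P? R P⇒⊆ ⊆⇒P i []       = refl
  seq-sum-filter P? R P⇒⊆ ⊆⇒P i (S ∷ Ss) with P? S
  ... | yes PS = cong₂ ℚ._+_
    {x = seq (Pr complete S) i} (trans (seq-Pr S i) (sym (weight⊇-⊆ q R S (P⇒⊆ PS))))
    (seq-sum-filter P? R P⇒⊆ ⊆⇒P i Ss)
  ... | no ¬PS = trans (seq-sum-filter P? R P⇒⊆ ⊆⇒P i Ss) (sym (trans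
    (cong (ℚ._+ ∑ (weight⊇ q R) Ss) (weight⊇-⊈ q R S (¬PS ∘ ⊆⇒P)))
    (ℚₚ.+-identityˡ (∑ (weight⊇ q R) Ss))))

  seq-clq : ∀ C i → seq (clq complete C) i ≡ q ^ℚ triangular ∣ C ∣
  seq-clq C i = trans
    (seq-sum-filter (isClique? complete C) (innerEdges C) isClique⇒ isClique⇐ i (subsets (triangular n)))
    (trans (∑-weight⊇ q (innerEdges C)) (cong (q ^ℚ_) (∣innerEdges∣ C)))

  isαMaximalClique : ∀ {α k} →
    α ≤ fromℚ (q ^ℚ triangular k) →
    (∀ b → triangular (suc k) ℕ.≤ b → ¬ α ≤ fromℚ (q ^ℚ b)) →
    ∀ M → ∣ M ∣ ≡ k → IsαMaximalClique complete α M
  isαMaximalClique {α} α≤ α≰ M refl =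
    (λ ε 0<ε → Product.map₂ (λ h i N≤i →
      subst (λ c → seq α i ℚ.≤ c ℚ.+ ε) (sym (seq-clq M i)) (h i N≤i)) (α≤ ε 0<ε)) ,
    λ { (v , v∉M , α≤clq) → α≰ (triangular ∣ M ∪ ⁅ v ⁆ ∣)
      (triangular-mono (Subsetₚ.p⊂q⇒∣p∣<∣q∣
        (Subsetₚ.p⊆p∪q _ , v , Subsetₚ.x∈p∪q⁺ (inj₂ (Subsetₚ.x∈⁅x⁆ v)) , v∉M)))
      λ ε 0<ε → Product.map₂ (λ h i N≤i →
        subst (λ c → seq α i ℚ.≤ c ℚ.+ ε) (seq-clq (M ∪ ⁅ v ⁆) i) (h i N≤i)) (α≤clq ε 0<ε) }

-- Total length of an output that lists every k-subset

-- Each entry of xs is charged to its own occurrence in ys: that occurrence is deleted, and as xs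
-- has no repetitions, its remaining entries still lie in what is left.
sum-map-⊆ : ∀ {A : Set} (f : A → ℕ) {xs ys : List A} → Unique xs → (∀ {x} → x ∈ˡ xs → x ∈ˡ ys) →
  sum (List.map f xs) ℕ.≤ sum (List.map f ys)
sum-map-⊆ f []               xs⊆ys = z≤n
sum-map-⊆ f {x ∷ xs} (x∉xs ∷ unique) xs⊆ys with ∈ˡ.∈-∃++ (xs⊆ys (here refl))
... | as , bs , refl = begin
  f x ℕ.+ sum (List.map f xs)
    ≤⟨ ℕₚ.+-monoʳ-≤ (f x) (sum-map-⊆ f unique xs⊆as++bs) ⟩
  f x ℕ.+ sum (List.map f (as List.++ bs))
    ≡⟨ cong (f x ℕ.+_) (split as bs) ⟩
  f x ℕ.+ (sum (List.map f as) ℕ.+ sum (List.map f bs))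
    ≡⟨ swap (f x) (sum (List.map f as)) (sum (List.map f bs)) ⟩
  sum (List.map f as) ℕ.+ (f x ℕ.+ sum (List.map f bs))
    ≡⟨ split as (x ∷ bs) ⟨
  sum (List.map f (as List.++ x ∷ bs)) ∎
  where
  open ℕₚ.≤-Reasoning
  swap : ∀ a b c → a ℕ.+ (b ℕ.+ c) ≡ b ℕ.+ (a ℕ.+ c)
  swap = solve-∀
  split : ∀ as bs → sum (List.map f (as List.++ bs)) ≡ sum (List.map f as) ℕ.+ sum (List.map f bs)
  split as bs = trans (cong sum (Listₚ.map-++ f as bs)) (sum-++ (List.map f as) (List.map f bs))
  xs⊆as++bs : ∀ {y} → y ∈ˡ xs → y ∈ˡ as List.++ bs
  xs⊆as++bs y∈xs with ∈ˡ.∈-++⁻ as (xs⊆ys (there y∈xs))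
  ... | inj₁ y∈as         = ∈ˡ.∈-++⁺ˡ y∈as
  ... | inj₂ (here refl)  = contradiction refl (All.lookup x∉xs y∈xs)
  ... | inj₂ (there y∈bs) = ∈ˡ.∈-++⁺ʳ as y∈bs

sum-map-const : ∀ {A : Set} (f : A → ℕ) c xs → (∀ x → x ∈ˡ xs → f x ≡ c) →
  sum (List.map f xs) ≡ length xs ℕ.* c
sum-map-const f c []       f≡c = refl
sum-map-const f c (x ∷ xs) f≡c = cong₂ ℕ._+_ (f≡c x (here refl)) (sum-map-const f c xs λ y → f≡c y ∘ there)

sum-map-≥ : ∀ {A : Set} (f : A → ℕ) c xs → (∀ x → x ∈ˡ xs → c ℕ.≤ f x) →
  length xs ℕ.* c ℕ.≤ sum (List.map f xs)
sum-map-≥ f c []       c≤f = z≤n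
sum-map-≥ f c (x ∷ xs) c≤f = ℕₚ.+-mono-≤ (c≤f x (here refl)) (sum-map-≥ f c xs λ y → c≤f y ∘ there)

Unique-⊆⇒length-≤ : ∀ {A : Set} {xs ys : List A} → Unique xs → (∀ {x} → x ∈ˡ xs → x ∈ˡ ys) →
  length xs ℕ.≤ length ys
Unique-⊆⇒length-≤ {xs = xs} {ys} unique xs⊆ys = subst₂ ℕ._≤_
  (trans (sum-map-const (const 1) 1 xs λ _ _ → refl) (ℕₚ.*-identityʳ (length xs)))
  (trans (sum-map-const (const 1) 1 ys λ _ _ → refl) (ℕₚ.*-identityʳ (length ys)))
  (sum-map-⊆ (const 1) unique xs⊆ys)

elements : ∀ {n} → Subset n → List (Fin n)
elements []            = []
elements (inside ∷ M)  = zero ∷ List.map suc (elements M)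
elements (outside ∷ M) = List.map suc (elements M)

length-elements : ∀ {n} (M : Subset n) → length (elements M) ≡ ∣ M ∣
length-elements []            = refl
length-elements (inside ∷ M)  = cong suc (trans (Listₚ.length-map suc (elements M)) (length-elements M))
length-elements (outside ∷ M) = trans (Listₚ.length-map suc (elements M)) (length-elements M)

elements-unique : ∀ {n} (M : Subset n) → Unique (elements M)
elements-unique []            = []
elements-unique (inside ∷ M)  =
  Allₚ.map⁺ (All.tabulate λ _ ()) ∷ Uniqueₚ.map⁺ Finₚ.suc-injective (elements-unique M)
elements-unique (outside ∷ M) = Uniqueₚ.map⁺ Finₚ.suc-injective (elements-unique M)

∈-elements⁻ : ∀ {n} (M : Subset n) {v} → v ∈ˡ elements M → v ∈ M
∈-elements⁻ (inside ∷ M)  (here refl) = Vec.here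
∈-elements⁻ (inside ∷ M)  (there v∈) with ∈ˡ.∈-map⁻ suc v∈
... | w , w∈ , refl = Vec.there (∈-elements⁻ M w∈)
∈-elements⁻ (outside ∷ M) v∈ with ∈ˡ.∈-map⁻ suc v∈
... | w , w∈ , refl = Vec.there (∈-elements⁻ M w∈)

Lists⇒∣∣≤length : ∀ {n} {L : List (Fin n)} {M} → L Lists M → ∣ M ∣ ℕ.≤ length L
Lists⇒∣∣≤length {L = L} {M} (_ , L≈M) = subst (ℕ._≤ length L) (length-elements M)
  (Unique-⊆⇒length-≤ (elements-unique M) λ v∈ → Equivalence.from (L≈M _) (∈-elements⁻ M v∈))

Lists-injective : ∀ {n} {L : List (Fin n)} {M M′} → L Lists M → L Lists M′ → M ≡ M′
Lists-injective (_ , L≈M) (_ , L≈M′) = Subsetₚ.⊆-antisym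
  (λ v∈ → Equivalence.to (L≈M′ _) (Equivalence.from (L≈M _) v∈))
  (λ v∈ → Equivalence.to (L≈M _) (Equivalence.from (L≈M′ _) v∈))

subsetsOfSize : ∀ n → ℕ → List (Subset n)
subsetsOfSize zero    zero    = [] ∷ []
subsetsOfSize zero    (suc k) = []
subsetsOfSize (suc n) zero    = List.map (outside ∷_) (subsetsOfSize n zero)
subsetsOfSize (suc n) (suc k) =
  List.map (inside ∷_) (subsetsOfSize n k) List.++ List.map (outside ∷_) (subsetsOfSize n (suc k))

nC0≡1 : ∀ n → n choose 0 ≡ 1
nC0≡1 n = trans (nCk≡nC[n∸k] {0} {n} z≤n) (nCn≡1 n)

length-subsetsOfSize : ∀ n k → length (subsetsOfSize n k) ≡ n choose k
length-subsetsOfSize zero    zero    = refl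
length-subsetsOfSize zero    (suc k) = sym (k>n⇒nCk≡0 {0} {suc k} (s≤s z≤n))
length-subsetsOfSize (suc n) zero    = trans (Listₚ.length-map _ (subsetsOfSize n 0))
  (trans (length-subsetsOfSize n 0) (trans (nC0≡1 n) (sym (nC0≡1 (suc n)))))
length-subsetsOfSize (suc n) (suc k) = begin
  length (List.map (inside ∷_) (subsetsOfSize n k) List.++ List.map (outside ∷_) (subsetsOfSize n (suc k)))
    ≡⟨ Listₚ.length-++ (List.map (inside ∷_) (subsetsOfSize n k)) ⟩
  length (List.map (inside ∷_) (subsetsOfSize n k)) ℕ.+
  length (List.map (outside ∷_) (subsetsOfSize n (suc k)))
    ≡⟨ cong₂ ℕ._+_ (trans (Listₚ.length-map _ (subsetsOfSize n k)) (length-subsetsOfSize n k))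
                 (trans (Listₚ.length-map _ (subsetsOfSize n (suc k))) (length-subsetsOfSize n (suc k))) ⟩
  n choose k ℕ.+ n choose suc k
    ≡⟨ nCk+nC[k+1]≡[n+1]C[k+1] n k ⟩
  suc n choose suc k ∎
  where open ≡-Reasoning

subsetsOfSize-∣∣ : ∀ n k {M} → M ∈ˡ subsetsOfSize n k → ∣ M ∣ ≡ k
subsetsOfSize-∣∣ zero    zero    (here refl) = refl
subsetsOfSize-∣∣ (suc n) zero    M∈ with ∈ˡ.∈-map⁻ (outside ∷_) M∈
... | M , M∈ , refl = subsetsOfSize-∣∣ n zero M∈
subsetsOfSize-∣∣ (suc n) (suc k) M∈ with ∈ˡ.∈-++⁻ (List.map (inside ∷_) (subsetsOfSize n k)) M∈
... | inj₁ M∈ˡ with ∈ˡ.∈-map⁻ (inside ∷_) M∈ˡ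
...   | N , N∈ , refl = cong suc (subsetsOfSize-∣∣ n k N∈)
subsetsOfSize-∣∣ (suc n) (suc k) M∈ | inj₂ M∈ʳ with ∈ˡ.∈-map⁻ (outside ∷_) M∈ʳ
...   | N , N∈ , refl = subsetsOfSize-∣∣ n (suc k) N∈

subsetsOfSize-unique : ∀ n k → Unique (subsetsOfSize n k)
subsetsOfSize-unique zero    zero    = [] ∷ []
subsetsOfSize-unique zero    (suc k) = []
subsetsOfSize-unique (suc n) zero    = Uniqueₚ.map⁺ (λ { refl → refl }) (subsetsOfSize-unique n zero)
subsetsOfSize-unique (suc n) (suc k) = Uniqueₚ.++⁺
  (Uniqueₚ.map⁺ (λ { refl → refl }) (subsetsOfSize-unique n k))
  (Uniqueₚ.map⁺ (λ { refl → refl }) (subsetsOfSize-unique n (suc k)))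
  disjoint
  where
  disjoint : ∀ {M} →
    ¬ (M ∈ˡ List.map (inside ∷_) (subsetsOfSize n k) × M ∈ˡ List.map (outside ∷_) (subsetsOfSize n (suc k)))
  disjoint (M∈ , M∈′) with ∈ˡ.∈-map⁻ (inside ∷_) M∈ | ∈ˡ.∈-map⁻ (outside ∷_) M∈′
  ... | _ , _ , refl | _ , _ , ()

-- The output may hold irrelevant lists and several orderings of one set, so one listing per set is
-- selected. The selected lists are distinct because a list determines the set that it lists.
distinct-listings : ∀ {n k} {out : List (List (Fin n))} (Ms : List (Subset n)) → Unique Ms →
  (∀ M → M ∈ˡ Ms → k ℕ.≤ ∣ M ∣ × ∃[ L ] (L ∈ˡ out × L Lists M)) →
  ∃[ Ls ] (Unique Ls × length Ls ≡ length Ms ×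
           (∀ {L} → L ∈ˡ Ls → L ∈ˡ out × k ℕ.≤ length L × ∃[ M ] (M ∈ˡ Ms × L Lists M)))
distinct-listings []       []              listed = [] , [] , refl , λ ()
distinct-listings (M ∷ Ms) (M∉Ms ∷ unique) listed
  with listed M (here refl) | distinct-listings Ms unique (λ M′ → listed M′ ∘ there)
... | k≤M , L , L∈out , LM | Ls , uniqueLs , length≡ , good =
  L ∷ Ls ,
  All.tabulate (λ {L′} L′∈Ls L≡L′ → let _ , _ , M′ , M′∈Ms , L′M′ = good L′∈Ls in
    All.lookup M∉Ms M′∈Ms (Lists-injective LM (subst (_Lists M′) (sym L≡L′) L′M′))) ∷ uniqueLs ,
  cong suc length≡ ,
  λ { (here refl) → L∈out , ℕₚ.≤-trans k≤M (Lists⇒∣∣≤length LM) , M , here refl , LM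
    ; (there L′∈) → let L∈ , k≤ , M′ , M′∈ , L′M′ = good L′∈ in L∈ , k≤ , M′ , there M′∈ , L′M′ }

output-size : ∀ {n k} {out : List (List (Fin n))} →
  (∀ M → ∣ M ∣ ≡ k → ∃[ L ] (L ∈ˡ out × L Lists M)) →
  (n choose k) ℕ.* k ℕ.≤ sum (List.map length out)
output-size {n} {k} {out} listed
  with distinct-listings {k = k} {out} (subsetsOfSize n k) (subsetsOfSize-unique n k)
         (λ M M∈ → let ∣M∣≡k = subsetsOfSize-∣∣ n k M∈ in ℕₚ.≤-reflexive (sym ∣M∣≡k) , listed M ∣M∣≡k)
... | Ls , unique , length≡ , good = begin
  (n choose k) ℕ.* k         ≡⟨ cong (ℕ._* k) (trans length≡ (length-subsetsOfSize n k)) ⟨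
  length Ls ℕ.* k            ≤⟨ sum-map-≥ length k Ls (λ L L∈ → proj₁ (proj₂ (good L∈))) ⟩
  sum (List.map length Ls)   ≤⟨ sum-map-⊆ length unique (λ L∈ → proj₁ (good L∈)) ⟩
  sum (List.map length out)  ∎
  where open ℕₚ.≤-Reasoning

-- Lower bound for the middle binomial coefficient

-- Both sides count the (k+1)-subsets of n + 1 elements with one marked element. The proof is by
-- Pascal's rule.
absorption : ∀ n k → suc k ℕ.* (suc n choose suc k) ≡ suc n ℕ.* (n choose k)
absorption zero zero = refl
absorption zero (suc k) = begin
  suc (suc k) ℕ.* (1 choose suc (suc k))
    ≡⟨ cong (suc (suc k) ℕ.*_) (k>n⇒nCk≡0 {1} {suc (suc k)} (s≤s (s≤s z≤n))) ⟩
  suc (suc k) ℕ.* 0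
    ≡⟨ ℕₚ.*-zeroʳ (suc (suc k)) ⟩
  0
    ≡⟨ ℕₚ.*-zeroʳ 1 ⟨
  1 ℕ.* 0
    ≡⟨ cong (1 ℕ.*_) (k>n⇒nCk≡0 {0} {suc k} (s≤s z≤n)) ⟨
  1 ℕ.* (0 choose suc k) ∎
  where open ≡-Reasoning
absorption (suc n) zero = begin
  1 ℕ.* (suc (suc n) choose 1)
    ≡⟨ cong (1 ℕ.*_) (nCk+nC[k+1]≡[n+1]C[k+1] (suc n) 0) ⟨
  1 ℕ.* (suc n choose 0 ℕ.+ (suc n choose 1))
    ≡⟨ ℕₚ.*-distribˡ-+ 1 (suc n choose 0) (suc n choose 1) ⟩
  1 ℕ.* (suc n choose 0) ℕ.+ 1 ℕ.* (suc n choose 1)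
    ≡⟨ cong₂ ℕ._+_ (cong (1 ℕ.*_) (nC0≡1 (suc n))) (absorption n 0) ⟩
  1 ℕ.+ suc n ℕ.* (n choose 0)
    ≡⟨ cong (λ c → 1 ℕ.+ suc n ℕ.* c) (nC0≡1 n) ⟩
  suc (suc n) ℕ.* 1
    ≡⟨ cong (suc (suc n) ℕ.*_) (nC0≡1 (suc n)) ⟨
  suc (suc n) ℕ.* (suc n choose 0) ∎
  where open ≡-Reasoning
absorption (suc n) (suc k) = begin
  suc (suc k) ℕ.* (suc (suc n) choose suc (suc k))
    ≡⟨ cong (suc (suc k) ℕ.*_) (nCk+nC[k+1]≡[n+1]C[k+1] (suc n) (suc k)) ⟨
  suc (suc k) ℕ.* (suc n choose suc k ℕ.+ (suc n choose suc (suc k)))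
    ≡⟨ ℕₚ.*-distribˡ-+ (suc (suc k)) (suc n choose suc k) (suc n choose suc (suc k)) ⟩
  -- One copy of the first coefficient is split off, so that the factors k + 1 and k + 2 fit the two
  -- induction hypotheses.
  (suc n choose suc k ℕ.+ suc k ℕ.* (suc n choose suc k)) ℕ.+ suc (suc k) ℕ.* (suc n choose suc (suc k))
    ≡⟨ cong₂ (λ a b → (suc n choose suc k ℕ.+ a) ℕ.+ b) (absorption n k) (absorption n (suc k)) ⟩
  (suc n choose suc k ℕ.+ suc n ℕ.* (n choose k)) ℕ.+ suc n ℕ.* (n choose suc k)
    ≡⟨ ℕₚ.+-assoc (suc n choose suc k) (suc n ℕ.* (n choose k)) (suc n ℕ.* (n choose suc k)) ⟩
  suc n choose suc k ℕ.+ (suc n ℕ.* (n choose k) ℕ.+ suc n ℕ.* (n choose suc k))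
    ≡⟨ cong (suc n choose suc k ℕ.+_) (ℕₚ.*-distribˡ-+ (suc n) (n choose k) (n choose suc k)) ⟨
  suc n choose suc k ℕ.+ suc n ℕ.* (n choose k ℕ.+ (n choose suc k))
    ≡⟨ cong (λ c → suc n choose suc k ℕ.+ suc n ℕ.* c) (nCk+nC[k+1]≡[n+1]C[k+1] n k) ⟩
  suc (suc n) ℕ.* (suc n choose suc k) ∎
  where open ≡-Reasoning

centralBinomial : ℕ → ℕ
centralBinomial k = (k ℕ.+ k) choose k

-- Absorption leads down to row 2k + 1 at k; the symmetry of that row moves to k + 1, where
-- absorption applies again.
centralBinomial-suc : ∀ k →
  suc k ℕ.* centralBinomial (suc k) ≡ 2 ℕ.* (suc (k ℕ.+ k) ℕ.* centralBinomial k)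
centralBinomial-suc k = begin
  suc k ℕ.* ((suc k ℕ.+ suc k) choose suc k)
    ≡⟨ cong (λ n → suc k ℕ.* (suc n choose suc k)) (ℕₚ.+-suc k k) ⟩
  suc k ℕ.* (suc (suc (k ℕ.+ k)) choose suc k)
    ≡⟨ absorption (suc (k ℕ.+ k)) k ⟩
  suc (suc (k ℕ.+ k)) ℕ.* (suc (k ℕ.+ k) choose k)
    ≡⟨ cong (suc (suc (k ℕ.+ k)) ℕ.*_) symmetric ⟩
  suc (suc (k ℕ.+ k)) ℕ.* (suc (k ℕ.+ k) choose suc k)
    ≡⟨ regroup k (suc (k ℕ.+ k) choose suc k) ⟩
  2 ℕ.* (suc k ℕ.* (suc (k ℕ.+ k) choose suc k))
    ≡⟨ cong (2 ℕ.*_) (absorption (k ℕ.+ k) k) ⟩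
  2 ℕ.* (suc (k ℕ.+ k) ℕ.* centralBinomial k) ∎
  where
  open ≡-Reasoning
  regroup : ∀ k y → suc (suc (k ℕ.+ k)) ℕ.* y ≡ 2 ℕ.* (suc k ℕ.* y)
  regroup = solve-∀
  symmetric : suc (k ℕ.+ k) choose k ≡ suc (k ℕ.+ k) choose suc k
  symmetric = trans (nCk≡nC[n∸k] {k} {suc (k ℕ.+ k)} (ℕₚ.m≤n⇒m≤1+n (ℕₚ.m≤m+n k k)))
    (cong (suc (k ℕ.+ k) choose_) (ℕₚ.m+n∸n≡m (suc k) k))

-- Squaring avoids √k. By the recurrence the induction step reduces to 4k(k+1) ≤ (2k+1)², where the
-- difference is 1. At k = 1 there is equality, 16 = 4·2².
16^k≤4k*centralBinomial² : ∀ k → 1 ℕ.≤ k →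
  16 ^ k ℕ.≤ 4 ℕ.* k ℕ.* (centralBinomial k ℕ.* centralBinomial k)
16^k≤4k*centralBinomial² (suc zero)      _ = ℕₚ.≤-refl
16^k≤4k*centralBinomial² (suc k@(suc _)) _ = ℕₚ.*-cancelˡ-≤ (suc k) (begin
  suc k ℕ.* (16 ℕ.* 16 ^ k)
    ≤⟨ ℕₚ.*-monoʳ-≤ (suc k) (ℕₚ.*-monoʳ-≤ 16 (16^k≤4k*centralBinomial² k (s≤s z≤n))) ⟩
  suc k ℕ.* (16 ℕ.* (4 ℕ.* k ℕ.* (b ℕ.* b)))
    ≤⟨ ℕₚ.m≤m+n _ (16 ℕ.* (b ℕ.* b)) ⟩
  suc k ℕ.* (16 ℕ.* (4 ℕ.* k ℕ.* (b ℕ.* b))) ℕ.+ 16 ℕ.* (b ℕ.* b)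
    ≡⟨ square k b ⟩
  4 ℕ.* ((2 ℕ.* (suc (k ℕ.+ k) ℕ.* b)) ℕ.* (2 ℕ.* (suc (k ℕ.+ k) ℕ.* b)))
    ≡⟨ cong (λ x → 4 ℕ.* (x ℕ.* x)) (centralBinomial-suc k) ⟨
  4 ℕ.* ((suc k ℕ.* b′) ℕ.* (suc k ℕ.* b′))
    ≡⟨ regroup (suc k) b′ ⟩
  suc k ℕ.* (4 ℕ.* suc k ℕ.* (b′ ℕ.* b′)) ∎)
  where
  open ℕₚ.≤-Reasoning
  b b′ : ℕ
  b  = centralBinomial k
  b′ = centralBinomial (suc k)
  square : ∀ k b → suc k ℕ.* (16 ℕ.* (4 ℕ.* k ℕ.* (b ℕ.* b))) ℕ.+ 16 ℕ.* (b ℕ.* b) ≡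
    4 ℕ.* ((2 ℕ.* (suc (k ℕ.+ k) ℕ.* b)) ℕ.* (2 ℕ.* (suc (k ℕ.+ k) ℕ.* b)))
  square = solve-∀
  regroup : ∀ k b → 4 ℕ.* ((k ℕ.* b) ℕ.* (k ℕ.* b)) ≡ k ℕ.* (4 ℕ.* k ℕ.* (b ℕ.* b))
  regroup = solve-∀

2^2k*2^2k≡16^k : ∀ k → 2 ^ (k ℕ.+ k) ℕ.* 2 ^ (k ℕ.+ k) ≡ 16 ^ k
2^2k*2^2k≡16^k k = begin
  2 ^ (k ℕ.+ k) ℕ.* 2 ^ (k ℕ.+ k)  ≡⟨ ℕₚ.^-distribˡ-+-* 2 (k ℕ.+ k) (k ℕ.+ k) ⟨
  2 ^ (k ℕ.+ k ℕ.+ (k ℕ.+ k))      ≡⟨ cong (2 ^_) (quadruple k) ⟩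
  2 ^ (4 ℕ.* k)                    ≡⟨ ℕₚ.^-*-assoc 2 4 k ⟨
  16 ^ k                           ∎
  where
  open ≡-Reasoning
  quadruple : ∀ k → k ℕ.+ k ℕ.+ (k ℕ.+ k) ≡ 4 ℕ.* k
  quadruple = solve-∀

halve : ∀ n → ∃[ k ] (n ≡ k ℕ.+ k ⊎ n ≡ suc (k ℕ.+ k))
halve zero = 0 , inj₁ refl
halve (suc n) with halve n
... | k , inj₁ refl = k , inj₂ refl
... | k , inj₂ refl = suc k , inj₁ (cong suc (sym (ℕₚ.+-suc k k)))

-- Origin of 7: n ≤ 3k and 2^n ≤ 2·4^k give n·4^n ≤ 12k·16^k ≤ 48(b·k)², and 49 is the next square.
-- Here b is C(2k,k), at most C(n,k) for both parities.
middle-binomial-bound : ∀ n k → 1 ℕ.≤ k → n ≡ k ℕ.+ k ⊎ n ≡ suc (k ℕ.+ k) →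
  n ℕ.* (2 ^ n ℕ.* 2 ^ n) ℕ.≤ (7 ℕ.* ((n choose k) ℕ.* k)) ℕ.* (7 ℕ.* ((n choose k) ℕ.* k))
middle-binomial-bound n k 1≤k half = begin
  n ℕ.* (2 ^ n ℕ.* 2 ^ n)
    ≤⟨ ℕₚ.*-mono-≤ n≤3k (ℕₚ.*-mono-≤ 2ⁿ≤ 2ⁿ≤) ⟩
  3 ℕ.* k ℕ.* ((2 ℕ.* 2 ^ (k ℕ.+ k)) ℕ.* (2 ℕ.* 2 ^ (k ℕ.+ k)))
    ≡⟨ collect k (2 ^ (k ℕ.+ k)) ⟩
  12 ℕ.* k ℕ.* (2 ^ (k ℕ.+ k) ℕ.* 2 ^ (k ℕ.+ k))
    ≡⟨ cong (12 ℕ.* k ℕ.*_) (2^2k*2^2k≡16^k k) ⟩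
  12 ℕ.* k ℕ.* 16 ^ k
    ≤⟨ ℕₚ.*-monoʳ-≤ (12 ℕ.* k) (16^k≤4k*centralBinomial² k 1≤k) ⟩
  12 ℕ.* k ℕ.* (4 ℕ.* k ℕ.* (b ℕ.* b))
    ≤⟨ ℕₚ.m≤m+n _ ((b ℕ.* k) ℕ.* (b ℕ.* k)) ⟩
  12 ℕ.* k ℕ.* (4 ℕ.* k ℕ.* (b ℕ.* b)) ℕ.+ (b ℕ.* k) ℕ.* (b ℕ.* k)
    ≡⟨ square k b ⟩
  (7 ℕ.* (b ℕ.* k)) ℕ.* (7 ℕ.* (b ℕ.* k))
    ≤⟨ ℕₚ.*-mono-≤ 7bk≤ 7bk≤ ⟩
  (7 ℕ.* ((n choose k) ℕ.* k)) ℕ.* (7 ℕ.* ((n choose k) ℕ.* k)) ∎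
  where
  open ℕₚ.≤-Reasoning
  b : ℕ
  b = centralBinomial k
  collect : ∀ k x → 3 ℕ.* k ℕ.* ((2 ℕ.* x) ℕ.* (2 ℕ.* x)) ≡ 12 ℕ.* k ℕ.* (x ℕ.* x)
  collect = solve-∀
  square : ∀ k b → 12 ℕ.* k ℕ.* (4 ℕ.* k ℕ.* (b ℕ.* b)) ℕ.+ (b ℕ.* k) ℕ.* (b ℕ.* k) ≡
    (7 ℕ.* (b ℕ.* k)) ℕ.* (7 ℕ.* (b ℕ.* k))
  square = solve-∀
  n≤ : n ≡ k ℕ.+ k ⊎ n ≡ suc (k ℕ.+ k) → n ℕ.≤ suc (k ℕ.+ k)
  n≤ (inj₁ refl) = ℕₚ.n≤1+n (k ℕ.+ k)
  n≤ (inj₂ refl) = ℕₚ.≤-refl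
  triple : ∀ k → k ℕ.+ (k ℕ.+ k) ≡ 3 ℕ.* k
  triple = solve-∀
  n≤3k : n ℕ.≤ 3 ℕ.* k
  n≤3k = ℕₚ.≤-trans (n≤ half)
    (ℕₚ.≤-trans (ℕₚ.+-monoˡ-≤ (k ℕ.+ k) 1≤k) (ℕₚ.≤-reflexive (triple k)))
  2ⁿ≤ : 2 ^ n ℕ.≤ 2 ℕ.* 2 ^ (k ℕ.+ k)
  2ⁿ≤ = ℕₚ.^-monoʳ-≤ 2 (n≤ half)
  odd : ∀ k → centralBinomial k ℕ.≤ suc (k ℕ.+ k) choose k
  odd zero    = ℕₚ.≤-refl
  odd (suc k) = subst (centralBinomial (suc k) ℕ.≤_)
    (nCk+nC[k+1]≡[n+1]C[k+1] (suc k ℕ.+ suc k) k) (ℕₚ.m≤n+m _ _)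
  b≤ : n ≡ k ℕ.+ k ⊎ n ≡ suc (k ℕ.+ k) → b ℕ.≤ n choose k
  b≤ (inj₁ refl) = ℕₚ.≤-refl
  b≤ (inj₂ refl) = odd k
  7bk≤ : 7 ℕ.* (b ℕ.* k) ℕ.≤ 7 ℕ.* ((n choose k) ℕ.* k)
  7bk≤ = ℕₚ.*-monoʳ-≤ 7 (ℕₚ.*-monoˡ-≤ k (b≤ half))

-- Passing from natural numbers to the real bound

square-cancel-≤ : ∀ {a b} → a ℕ.* a ℕ.≤ b ℕ.* b → a ℕ.≤ b
square-cancel-≤ a²≤b² = ℕₚ.≮⇒≥ λ b<a → ℕₚ.<⇒≱ (ℕₚ.*-mono-< b<a b<a) a²≤b²

-- The approximations of √n lie below it, so the inequality holds at every index. Clearing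
-- denominators and squaring leaves `isqrt-lower` and the hypothesis.
scaled-√-≤ : ∀ d n x y → n ℕ.* (x ℕ.* x) ℕ.≤ (suc d ℕ.* y) ℕ.* (suc d ℕ.* y) →
  fromℚ (+ 1 ℚ./ suc d) * (√ n * fromℕ x) ≤ fromℕ y
scaled-√-≤ d n x y nx²≤ ε 0<ε = 0 , λ i _ → ℚₚ.≤-trans (pointwise i) (≤-by ε (ℚₚ.<⇒≤ 0<ε) refl)
  where
  numerators : ∀ i → isqrt (n ℕ.* (suc i ℕ.* suc i)) ℕ.* x ℕ.≤ suc d ℕ.* y ℕ.* suc i
  numerators i = square-cancel-≤ (begin
    (s ℕ.* x) ℕ.* (s ℕ.* x)
      ≡⟨ squares s x ⟩
    (s ℕ.* s) ℕ.* (x ℕ.* x)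
      ≤⟨ ℕₚ.*-monoˡ-≤ (x ℕ.* x) (isqrt-lower (n ℕ.* (suc i ℕ.* suc i))) ⟩
    n ℕ.* (suc i ℕ.* suc i) ℕ.* (x ℕ.* x)
      ≡⟨ swap n (suc i ℕ.* suc i) (x ℕ.* x) ⟩
    n ℕ.* (x ℕ.* x) ℕ.* (suc i ℕ.* suc i)
      ≤⟨ ℕₚ.*-monoˡ-≤ (suc i ℕ.* suc i) nx²≤ ⟩
    (suc d ℕ.* y) ℕ.* (suc d ℕ.* y) ℕ.* (suc i ℕ.* suc i)
      ≡⟨ squares (suc d ℕ.* y) (suc i) ⟨
    (suc d ℕ.* y ℕ.* suc i) ℕ.* (suc d ℕ.* y ℕ.* suc i) ∎)
    where
    open ℕₚ.≤-Reasoning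
    s : ℕ
    s = isqrt (n ℕ.* (suc i ℕ.* suc i))
    squares : ∀ a b → (a ℕ.* b) ℕ.* (a ℕ.* b) ≡ (a ℕ.* a) ℕ.* (b ℕ.* b)
    squares = solve-∀
    swap : ∀ a b c → a ℕ.* b ℕ.* c ≡ a ℕ.* c ℕ.* b
    swap = solve-∀
  pointwise : ∀ i → (+ 1 ℚ./ suc d) ℚ.* (√-seq n i ℚ.* (+ x ℚ./ 1)) ℚ.≤ + y ℚ./ 1
  pointwise i = ℚₚ.toℚᵘ-cancel-≤ (begin
    ℚ.toℚᵘ ((+ 1 ℚ./ suc d) ℚ.* (√-seq n i ℚ.* (+ x ℚ./ 1)))
      ≃⟨ ℚₚ.toℚᵘ-homo-* (+ 1 ℚ./ suc d) (√-seq n i ℚ.* (+ x ℚ./ 1)) ⟩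
    ℚ.toℚᵘ (+ 1 ℚ./ suc d) ℚᵘ.* ℚ.toℚᵘ (√-seq n i ℚ.* (+ x ℚ./ 1))
      ≃⟨ ℚᵘₚ.*-cong (toℚᵘ-/ 1 d) (ℚᵘₚ.≃-trans (ℚₚ.toℚᵘ-homo-* (√-seq n i) (+ x ℚ./ 1))
           (ℚᵘₚ.*-cong (toℚᵘ-/ s i) (toℚᵘ-/ x 0))) ⟩
    mkℚᵘ (+ 1) d ℚᵘ.* (mkℚᵘ (+ s) i ℚᵘ.* mkℚᵘ (+ x) 0)
      ≤⟨ ℚᵘ.*≤* (subst₂ ℤ._≤_ lhs rhs (ℤ.+≤+ (numerators i))) ⟩
    mkℚᵘ (+ y) 0
      ≃⟨ toℚᵘ-/ y 0 ⟨
    ℚ.toℚᵘ (+ y ℚ./ 1) ∎)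
    where
    open ℚᵘₚ.≤-Reasoning
    s : ℕ
    s = isqrt (n ℕ.* (suc i ℕ.* suc i))
    lhs : + (s ℕ.* x) ≡ (+ 1 ℤ.* (+ s ℤ.* + x)) ℤ.* + 1
    lhs = trans (ℤₚ.pos-* s x) (sym (trans (ℤₚ.*-identityʳ _) (ℤₚ.*-identityˡ (+ s ℤ.* + x))))
    rhs : + (suc d ℕ.* y ℕ.* suc i) ≡ + y ℤ.* + (suc d ℕ.* (suc i ℕ.* 1))
    rhs = trans (cong +_ (rearrange (suc d) y (suc i))) (ℤₚ.pos-* y (suc d ℕ.* (suc i ℕ.* 1)))
      where
      rearrange : ∀ d y i → d ℕ.* y ℕ.* i ≡ y ℕ.* (d ℕ.* (i ℕ.* 1))
      rearrange = solve-∀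

-- Source of the threshold 4: the choice of q needs a k-set to contain at least one pair, hence k ≥
-- 2.
2≤half : ∀ {n} k → 4 ℕ.≤ n → n ≡ k ℕ.+ k ⊎ n ≡ suc (k ℕ.+ k) → 2 ℕ.≤ k
2≤half (suc (suc k)) _ _ = s≤s (s≤s z≤n)
2≤half zero () (inj₁ refl)
2≤half zero (s≤s ()) (inj₂ refl)
2≤half (suc zero) (s≤s (s≤s ())) (inj₁ refl)
2≤half (suc zero) (s≤s (s≤s (s≤s ()))) (inj₂ refl)

mainTheorem4 : (α : ℝ) → 0ℝ < α → α < 1ℝ → (A : Algorithm α) →
    WorstCaseΩ (Algorithm.time A) (λ n → √ n * fromℕ (2 ^ n))
mainTheorem4 α 0<α α<1 A =
  fromℚ (+ 1 ℚ./ 7) , (+ 1 ℚ./ 7 , ℚₚ.positive⁻¹ (+ 1 ℚ./ 7) , 0 ,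
    λ _ _ → ℚₚ.≤-reflexive (ℚₚ.+-identityˡ (+ 1 ℚ./ 7))) , 4 , worst
  where
  open Algorithm A
  worst : ∀ n → 4 ℕ.≤ n → WorstCase≥ time n (fromℚ (+ 1 ℚ./ 7) * (√ n * fromℕ (2 ^ n)))
  worst n 4≤n =
    let k , half = halve n
        2≤k = 2≤half k 4≤n half
        q , 0<q , q≤1 , α≤ , α≰ = separating-probability α 0<α α<1 (triangular k) k
          (triangular-mono 2≤k) (ℕₚ.<⇒≤ 2≤k)
        G = complete n q 0<q q≤1
        size≤time = ℕₚ.≤-trans
          (output-size {k = k} λ M ∣M∣≡k → outputs-all G M (isαMaximalClique n q 0<q q≤1 {α} {k} α≤
            (λ b tri≤b → α≰ b (subst (ℕ._≤ b) (ℕₚ.+-comm k (triangular k)) tri≤b)) M ∣M∣≡k))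
          (output-cost G)
    -- The 6 stands for the denominator 7 = `suc 6`.
    in G , scaled-√-≤ 6 n (2 ^ n) (time G)
      (ℕₚ.≤-trans (middle-binomial-bound n k (ℕₚ.<⇒≤ 2≤k) half)
        (ℕₚ.*-mono-≤ (ℕₚ.*-monoʳ-≤ 7 size≤time) (ℕₚ.*-monoʳ-≤ 7 size≤time)))
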